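{- Let $n \ge 2$ be an integer and let $0 < \alpha < 1$. Let $f(n,\alpha)$ denote the maximum, over all uncertain graphs $\mathcal{G}=(V,E,p)$ with $|V|=n$ (with no restriction on the edge set or on the edge probabilities), of the number of $\alpha$-maximal cliques in $\mathcal{G}$. Then $$f(n,\alpha) = \binom{n}{\lfloor n/2 \rfloor}.$$
   Context: An uncertain graph is a triple $\mathcal{G}=(V,E,p)$, where $V$ is a finite set of vertices, $E$ is a set of undirected edges on $V$ (no self-loops, no multiple edges), and $p:E\to(0,1]$ assigns to each edge its probability of existence. It represents the probability distribution over subgraphs of $(V,E)$ on vertex set $V$ obtained by including each edge $e\in E$ independently with probability $p(e)$. A set $C\subseteq V$ is a clique in a deterministic graph if every pair of distinct vertices of $C$ is joined by an edge. For $C\subseteq V$, the clique probability $\mathrm{clq}(C,\mathcal{G})$ is the probability that $C$ is a clique in a graph sampled from $\mathcal{G}$ (so it equals the product of $p(e)$ over all pairs $e$ of distinct vertices of $C$ if all these pairs lie in $E$, and is $0$ otherwise; sets of size at most $1$ have clique probability $1$). $C$ is an $\alpha$-clique if $\mathrm{clq}(C,\mathcal{G})\ge\alpha$. A set $M\subseteq V$ is an $\alpha$-maximal clique if $M$ is an $\alpha$-clique and there is no $v\in V\setminus M$ such that $M\cup\{v\}$ is an $\alpha$-clique. -}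

module Defs where

open import Data.Bool.Base using (if_then_else_)
open import Data.Fin.Base using (Fin)
import Data.Fin.Properties as Fin
open import Data.Fin.Subset using (Subset; inside; outside; _∈_; _∉_; _∪_; ⁅_⁆)
open import Data.Fin.Subset.Properties using (_∈?_)
open import Data.List.Base as List using (List; []; _∷_; _++_; length)
import Data.List.Membership.Propositional as List
open import Data.List.Relation.Unary.Unique.Propositional using (Unique)
open import Data.Nat.Base as ℕ using (ℕ; zero; suc; _⊔_)
import Data.Nat.Properties as ℕ
open import Data.Product.Base using (∃-syntax; Σ-syntax; _×_; _,_)
open import Data.Product.Properties using (≡-dec)
open import Data.Rational.Base as ℚ using (ℚ; 0ℚ; 1ℚ; ½; ∣_∣; Positive; positive)
import Data.Rational.Properties as ℚ
open import Data.Rational.Solver using (module +-*-Solver)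
open import Data.Sum.Base using (_⊎_)
open import Data.Vec.Base using ([]; _∷_)
import Data.Vec.Functional as Vector
open import Function.Bundles using (_⇔_)
open import Level using (Level) renaming (_⊔_ to _⊔ˡ_)
open import Relation.Binary.PropositionalEquality
  using (_≡_; _≢_; refl; sym; trans; cong; cong₂; subst)
open import Relation.Nullary.Decidable using (Dec; does; ¬?; _×-dec_; _⊎-dec_; _→-dec_)
open import Relation.Nullary.Negation using (¬_)
open import Relation.Unary using (Pred; Decidable)

private
  variable
    a ℓ : Level
    A : Set a
    m n : ℕ

------------------------------------------------------------------------
-- Real numbers as Cauchy sequences of rationals. Two sequences denote
-- the same real when their difference tends to 0; _≤ᴿ_ and _<ᴿ_ respect
-- this, and no other relation between reals is used.

infix  4 _≤ᴿ_ _<ᴿ_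
infixl 6 _+ᴿ_ _-ᴿ_
infixl 7 _*ᴿ_

IsCauchy : (ℕ → ℚ) → Set
IsCauchy x = ∀ ε → 0ℚ ℚ.< ε →
  ∃[ N ] (∀ i j → N ℕ.≤ i → N ℕ.≤ j → ∣ x i ℚ.- x j ∣ ℚ.< ε)

record ℝ : Set where
  constructor mkℝ
  field
    seq    : ℕ → ℚ
    cauchy : IsCauchy seq

open ℝ public

_≤ᴿ_ : ℝ → ℝ → Set
x ≤ᴿ y = ∀ ε → 0ℚ ℚ.< ε → ∃[ N ] (∀ i → N ℕ.≤ i → seq x i ℚ.≤ seq y i ℚ.+ ε)

_<ᴿ_ : ℝ → ℝ → Set
x <ᴿ y = ∃[ ε ] (0ℚ ℚ.< ε × ∃[ N ] (∀ i → N ℕ.≤ i → seq x i ℚ.+ ε ℚ.≤ seq y i))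

½-sum : ∀ ε → ½ ℚ.* ε ℚ.+ ½ ℚ.* ε ≡ ε
½-sum ε = trans (sym (ℚ.*-distribʳ-+ ε ½ ½)) (ℚ.*-identityˡ ε)

½-pos : ∀ {ε} → 0ℚ ℚ.< ε → 0ℚ ℚ.< ½ ℚ.* ε
½-pos {ε} 0<ε = subst (ℚ._< ½ ℚ.* ε) (ℚ.*-zeroʳ ½) (ℚ.*-monoʳ-<-pos ½ 0<ε)

const-cauchy : ∀ q → IsCauchy (λ _ → q)
const-cauchy q ε 0<ε = 0 , λ _ _ _ _ →
  subst (λ r → ∣ r ∣ ℚ.< ε) (sym (ℚ.+-inverseʳ q)) 0<ε

+-cauchy : ∀ x y → IsCauchy x → IsCauchy y → IsCauchy (λ i → x i ℚ.+ y i)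
+-cauchy x y cx cy ε 0<ε with cx (½ ℚ.* ε) (½-pos 0<ε) | cy (½ ℚ.* ε) (½-pos 0<ε)
... | N , hx | M , hy = N ⊔ M , λ i j i≥ j≥ → begin-strict
  ∣ (x i ℚ.+ y i) ℚ.- (x j ℚ.+ y j) ∣
    ≡⟨ cong ∣_∣ (rearrange (x i) (y i) (x j) (y j)) ⟩
  ∣ (x i ℚ.- x j) ℚ.+ (y i ℚ.- y j) ∣
    ≤⟨ ℚ.∣p+q∣≤∣p∣+∣q∣ (x i ℚ.- x j) (y i ℚ.- y j) ⟩
  ∣ x i ℚ.- x j ∣ ℚ.+ ∣ y i ℚ.- y j ∣
    <⟨ ℚ.+-mono-< (hx i j (ℕ.m⊔n≤o⇒m≤o N M i≥) (ℕ.m⊔n≤o⇒m≤o N M j≥))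
                  (hy i j (ℕ.m⊔n≤o⇒n≤o N M i≥) (ℕ.m⊔n≤o⇒n≤o N M j≥)) ⟩
  ½ ℚ.* ε ℚ.+ ½ ℚ.* ε
    ≡⟨ ½-sum ε ⟩
  ε ∎
  where
  open ℚ.≤-Reasoning
  open +-*-Solver
  rearrange : ∀ p q r s → (p ℚ.+ q) ℚ.- (r ℚ.+ s) ≡ (p ℚ.- r) ℚ.+ (q ℚ.- s)
  rearrange = solve 4 (λ p q r s → (p :+ q) :- (r :+ s) := (p :- r) :+ (q :- s)) refl

neg-cauchy : ∀ x → IsCauchy x → IsCauchy (λ i → ℚ.- x i)
neg-cauchy x cx ε 0<ε with cx ε 0<ε
... | N , hx = N , λ i j i≥ j≥ →
  subst (ℚ._< ε)
    (trans (sym (ℚ.∣-p∣≡∣p∣ (x i ℚ.- x j))) (cong ∣_∣ (ℚ.neg-distrib-+ (x i) (ℚ.- x j))))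
    (hx i j i≥ j≥)

cauchy-bound : ∀ x → IsCauchy x →
  ∃[ B ] (0ℚ ℚ.< B × ∃[ N ] (∀ i → N ℕ.≤ i → ∣ x i ∣ ℚ.≤ B))
cauchy-bound x cx with cx 1ℚ (ℚ.positive⁻¹ 1ℚ)
... | N , hx = 1ℚ ℚ.+ ∣ x N ∣ , ℚ.+-mono-<-≤ (ℚ.positive⁻¹ 1ℚ) (ℚ.0≤∣p∣ (x N)) , N , λ i i≥ → begin
  ∣ x i ∣
    ≡⟨ cong ∣_∣ (split (x i) (x N)) ⟩
  ∣ (x i ℚ.- x N) ℚ.+ x N ∣
    ≤⟨ ℚ.∣p+q∣≤∣p∣+∣q∣ (x i ℚ.- x N) (x N) ⟩
  ∣ x i ℚ.- x N ∣ ℚ.+ ∣ x N ∣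
    ≤⟨ ℚ.+-monoˡ-≤ ∣ x N ∣ (ℚ.<⇒≤ (hx i N i≥ ℕ.≤-refl)) ⟩
  1ℚ ℚ.+ ∣ x N ∣ ∎
  where
  open ℚ.≤-Reasoning
  open +-*-Solver
  split : ∀ p q → p ≡ (p ℚ.- q) ℚ.+ q
  split = solve 2 (λ p q → p := (p :- q) :+ q) refl

scale-down : ∀ {B δ} → 0ℚ ℚ.< B → 0ℚ ℚ.< δ → ∃[ η ] (0ℚ ℚ.< η × B ℚ.* η ≡ δ)
scale-down {B} {δ} 0<B 0<δ = B⁻¹ ℚ.* δ , 0<η , eq
  where
  instance
    B-pos : Positive B
    B-pos = positive 0<B
    B-nonZero : ℚ.NonZero B
    B-nonZero = ℚ.pos⇒nonZero B
  B⁻¹ : ℚ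
  B⁻¹ = ℚ.1/ B
  instance
    B⁻¹-pos : Positive B⁻¹
    B⁻¹-pos = ℚ.1/pos⇒pos B
  0<η : 0ℚ ℚ.< B⁻¹ ℚ.* δ
  0<η = subst (ℚ._< B⁻¹ ℚ.* δ) (ℚ.*-zeroʳ B⁻¹) (ℚ.*-monoʳ-<-pos B⁻¹ 0<δ)
  eq : B ℚ.* (B⁻¹ ℚ.* δ) ≡ δ
  eq = trans (sym (ℚ.*-assoc B B⁻¹ δ))
             (trans (cong (ℚ._* δ) (ℚ.*-inverseʳ B)) (ℚ.*-identityˡ δ))

∣*∣-bound : ∀ {B η} p q → 0ℚ ℚ.< B → ∣ p ∣ ℚ.≤ B → ∣ q ∣ ℚ.< η → ∣ p ℚ.* q ∣ ℚ.< B ℚ.* η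
∣*∣-bound {B} {η} p q 0<B p≤B q<η = begin-strict
  ∣ p ℚ.* q ∣
    ≡⟨ ℚ.∣p*q∣≡∣p∣*∣q∣ p q ⟩
  ∣ p ∣ ℚ.* ∣ q ∣
    ≤⟨ ℚ.*-monoʳ-≤-nonNeg ∣ q ∣ {{ℚ.nonNegative (ℚ.0≤∣p∣ q)}} p≤B ⟩
  B ℚ.* ∣ q ∣
    <⟨ ℚ.*-monoʳ-<-pos B {{positive 0<B}} q<η ⟩
  B ℚ.* η ∎
  where open ℚ.≤-Reasoning

*-cauchy-step : ∀ {B C η θ} p q r s → 0ℚ ℚ.< B → 0ℚ ℚ.< C →
  ∣ p ∣ ℚ.≤ B → ∣ s ∣ ℚ.≤ C → ∣ q ℚ.- s ∣ ℚ.< η → ∣ p ℚ.- r ∣ ℚ.< θ →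
  ∣ p ℚ.* q ℚ.- r ℚ.* s ∣ ℚ.< B ℚ.* η ℚ.+ C ℚ.* θ
*-cauchy-step {B} {C} {η} {θ} p q r s 0<B 0<C p≤B s≤C q-s<η p-r<θ = begin-strict
  ∣ p ℚ.* q ℚ.- r ℚ.* s ∣
    ≡⟨ cong ∣_∣ (rearrange p q r s) ⟩
  ∣ p ℚ.* (q ℚ.- s) ℚ.+ s ℚ.* (p ℚ.- r) ∣
    ≤⟨ ℚ.∣p+q∣≤∣p∣+∣q∣ (p ℚ.* (q ℚ.- s)) (s ℚ.* (p ℚ.- r)) ⟩
  ∣ p ℚ.* (q ℚ.- s) ∣ ℚ.+ ∣ s ℚ.* (p ℚ.- r) ∣
    <⟨ ℚ.+-mono-< (∣*∣-bound p (q ℚ.- s) 0<B p≤B q-s<η)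
                  (∣*∣-bound s (p ℚ.- r) 0<C s≤C p-r<θ) ⟩
  B ℚ.* η ℚ.+ C ℚ.* θ ∎
  where
  open ℚ.≤-Reasoning
  open +-*-Solver
  rearrange : ∀ p q r s → p ℚ.* q ℚ.- r ℚ.* s ≡ p ℚ.* (q ℚ.- s) ℚ.+ s ℚ.* (p ℚ.- r)
  rearrange = solve 4 (λ p q r s →
    p :* q :- r :* s := p :* (q :- s) :+ s :* (p :- r)) refl

*-cauchy : ∀ x y → IsCauchy x → IsCauchy y → IsCauchy (λ i → x i ℚ.* y i)
*-cauchy x y cx cy ε 0<ε =
  let B , 0<B , K , x≤B = cauchy-bound x cx
      C , 0<C , L , y≤C = cauchy-bound y cy
      η , 0<η , Bη≡     = scale-down 0<B (½-pos 0<ε)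
      θ , 0<θ , Cθ≡     = scale-down 0<C (½-pos 0<ε)
      N , hx            = cx θ 0<θ
      M , hy            = cy η 0<η
  in (K ⊔ L) ⊔ (N ⊔ M) , λ i j i≥ j≥ →
  let K⊔L≤i = ℕ.m⊔n≤o⇒m≤o (K ⊔ L) (N ⊔ M) i≥
      K⊔L≤j = ℕ.m⊔n≤o⇒m≤o (K ⊔ L) (N ⊔ M) j≥
      N⊔M≤i = ℕ.m⊔n≤o⇒n≤o (K ⊔ L) (N ⊔ M) i≥
      N⊔M≤j = ℕ.m⊔n≤o⇒n≤o (K ⊔ L) (N ⊔ M) j≥
  in subst (∣ x i ℚ.* y i ℚ.- x j ℚ.* y j ∣ ℚ.<_)
       (trans (cong₂ ℚ._+_ Bη≡ Cθ≡) (½-sum ε))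
       (*-cauchy-step (x i) (y i) (x j) (y j) 0<B 0<C
         (x≤B i (ℕ.m⊔n≤o⇒m≤o K L K⊔L≤i))
         (y≤C j (ℕ.m⊔n≤o⇒n≤o K L K⊔L≤j))
         (hy i j (ℕ.m⊔n≤o⇒n≤o N M N⊔M≤i) (ℕ.m⊔n≤o⇒n≤o N M N⊔M≤j))
         (hx i j (ℕ.m⊔n≤o⇒m≤o N M N⊔M≤i) (ℕ.m⊔n≤o⇒m≤o N M N⊔M≤j)))

fromℚ : ℚ → ℝ
fromℚ q = mkℝ (λ _ → q) (const-cauchy q)

0ᴿ 1ᴿ : ℝ
0ᴿ = fromℚ 0ℚ
1ᴿ = fromℚ 1ℚ

_+ᴿ_ _*ᴿ_ _-ᴿ_ : ℝ → ℝ → ℝ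
x +ᴿ y = mkℝ (λ i → seq x i ℚ.+ seq y i) (+-cauchy (seq x) (seq y) (cauchy x) (cauchy y))
x *ᴿ y = mkℝ (λ i → seq x i ℚ.* seq y i) (*-cauchy (seq x) (seq y) (cauchy x) (cauchy y))
x -ᴿ y = mkℝ (λ i → seq x i ℚ.- seq y i)
  (+-cauchy (seq x) (λ i → ℚ.- seq y i) (cauchy x) (neg-cauchy (seq y) (cauchy y)))

∏ : (Fin m → ℝ) → ℝ
∏ = Vector.foldr _*ᴿ_ 1ᴿ

∑ : List A → (A → ℝ) → ℝ
∑ xs f = List.foldr _+ᴿ_ 0ᴿ (List.map f xs)

------------------------------------------------------------------------
-- Uncertain graphs on the vertex set Fin n. The finite edge set is
-- presented by an enumeration Fin #E without repetitions, each edge being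
-- given by its two endpoints in an arbitrary order; `simple` identifies
-- edges having the same unordered pair of endpoints.

record UncertainGraph (n : ℕ) : Set where
  field
    #E   : ℕ
    ends : Fin #E → Fin n × Fin n

  Joins : Fin #E → Fin n → Fin n → Set
  Joins e u v = (ends e ≡ (u , v)) ⊎ (ends e ≡ (v , u))

  field
    loopless : ∀ e v → ¬ Joins e v v
    simple   : ∀ e e′ u v → Joins e u v → Joins e′ u v → e ≡ e′
    p        : Fin #E → ℝ
    p-pos    : ∀ e → 0ᴿ <ᴿ p e
    p≤1      : ∀ e → p e ≤ᴿ 1ᴿ

  joins? : ∀ e u v → Dec (Joins e u v)
  joins? e u v = (ends e ≟ (u , v)) ⊎-dec (ends e ≟ (v , u))
    where _≟_ = ≡-dec Fin._≟_ Fin._≟_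

allSubsets : ∀ m → List (Subset m)
allSubsets zero    = [] ∷ []
allSubsets (suc m) = List.map (inside ∷_) (allSubsets m) ++ List.map (outside ∷_) (allSubsets m)

module _ (G : UncertainGraph n) where
  open UncertainGraph G

  -- A subset of the edges stands for the subgraph of (V , E) with those
  -- edges and all vertices.
  subgraphProb : Subset #E → ℝ
  subgraphProb S = ∏ λ e → if does (e ∈? S) then p e else (1ᴿ -ᴿ p e)

  Pr : {P : Pred (Subset #E) ℓ} → Decidable P → ℝ
  Pr P? = ∑ (allSubsets #E) λ S → if does (P? S) then subgraphProb S else 0ᴿ

  IsClique : Subset n → Subset #E → Set
  IsClique C S = ∀ u v → u ∈ C → v ∈ C → u ≢ v → ∃[ e ] (e ∈ S × Joins e u v)

  isClique? : ∀ C → Decidable (IsClique C)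
  isClique? C S = Fin.all? λ u → Fin.all? λ v →
    (u ∈? C) →-dec (v ∈? C) →-dec ¬? (u Fin.≟ v) →-dec
    Fin.any? λ e → (e ∈? S) ×-dec joins? e u v

  clq : Subset n → ℝ
  clq C = Pr (isClique? C)

  IsαClique : ℝ → Subset n → Set
  IsαClique α C = α ≤ᴿ clq C

  IsαMaximalClique : ℝ → Subset n → Set
  IsαMaximalClique α M =
    IsαClique α M × ¬ (∃[ v ] (v ∉ M × IsαClique α (M ∪ ⁅ v ⁆)))

------------------------------------------------------------------------

HasCount : {A : Set a} → Pred A ℓ → ℕ → Set (a ⊔ˡ ℓ)
HasCount {A = A} P k =
  Σ[ xs ∈ List A ] (Unique xs × (∀ x → (x List.∈ xs) ⇔ P x) × length xs ≡ k)

IsMaximum : Pred ℕ ℓ → ℕ → Set ℓ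
IsMaximum P N = P N × (∀ k → P k → k ℕ.≤ N)

-- The relation f(n,α) = N. Comparison of reals is undecidable, so the
-- number of α-maximal cliques is a relation rather than a function of G;
-- since every G classically has a count and ≤ on ℕ is ¬¬-stable, the
-- upper-bound part also bounds any duplicate-free list of α-maximal
-- cliques of any G.
MaxCliqueCount : ℕ → ℝ → ℕ → Set
MaxCliqueCount n α =
  IsMaximum λ k → Σ[ G ∈ UncertainGraph n ] HasCount (IsαMaximalClique G α) k

{-# OPTIONS --safe #-}

-- Upper bound: adding vertices can only lower a clique probability, so the α-maximal cliques form an
-- antichain, and Sperner's theorem applies. Sperner's theorem itself follows from the symmetric chain
-- decomposition of the Boolean lattice: sending a subset to the middle element of its chain is injective
-- on antichains.
--
-- Lower bound: in the complete graph with constant edge probability q, a set of s vertices has clique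
-- probability q ^ (s choose 2). Some rational q puts α strictly above the value for s = ⌊ n /2⌋ + 1 and at
-- most at the value for s = ⌊ n /2⌋; then the α-maximal cliques are exactly the sets of size ⌊ n /2⌋.

module Submission where

open import Defs
open import Algebra.Bundles using (CommutativeRing)
import Algebra.Properties.Semiring.Exp as Exp
import Algebra.Properties.Semiring.Mult as Mult
open import Data.Bool.Base using (true; false; if_then_else_; _∧_)
open import Data.Fin.Base as Fin using (Fin; zero; suc; toℕ; fromℕ; fromℕ<; inject₁; splitAt; join;
  _↑ˡ_; _↑ʳ_)
import Data.Fin.Properties as Fin
open import Data.Fin.Relation.Unary.Top
  using (View; ‵fromℕ; ‵inject₁; view; view-fromℕ; view-inject₁)
open import Data.Fin.Subset using (Subset; inside; outside; _∈_; _∉_; _⊆_; _∪_; ⁅_⁆; ∣_∣; ⊥; ∁)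
open import Data.Fin.Subset.Properties
  using (_∈?_; _⊆?_; ⊆-antisym; out⊆; s⊆s; x∈p∪q⁻; x∈⁅y⁆⇒x≡y; x∈∁p⇒x∉p; nonempty?; Empty-unique;
         ∣∁p∣≡n∸∣p∣; ∣⊥∣≡0; ∪-identityʳ)
import Data.Integer.Base as ℤ
import Data.Integer.Properties as ℤ
import Data.Integer.Solver as ℤ-Solver
open import Data.List.Base as List using (List; []; _∷_; _++_; length; lookup)
import Data.List.Membership.Propositional as List
open import Data.List.Membership.Propositional.Properties
  using (∈-lookup; ∈-map⁺; ∈-map⁻; ∈-++⁺ˡ; ∈-++⁺ʳ; ∈-++⁻)
open import Data.List.Properties using (length-map; length-++)
open import Data.List.Relation.Unary.All as All using ([]; _∷_)
open import Data.List.Relation.Unary.Any using (here; there; index)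
open import Data.List.Relation.Unary.Any.Properties using (lookup-index)
open import Data.List.Relation.Unary.Unique.Propositional using (Unique; []; _∷_)
import Data.List.Relation.Unary.Unique.Propositional.Properties as Unique
open import Data.Nat.Base as ℕ using (ℕ; zero; suc; _≤_; _<_; z≤n; s≤s; ⌊_/2⌋; _⊔_)
open import Data.Nat.Combinatorics using (_C_; nCk+nC[k+1]≡[n+1]C[k+1]; nCn≡1; nCk≡nC[n∸k])
open import Data.Nat.Coprimality using (Coprime)
import Data.Nat.Properties as ℕ
open import Data.Product.Base as Product using (∃-syntax; Σ-syntax; _×_; _,_; proj₁; proj₂; uncurry)
open import Data.Product.Properties using (,-injectiveˡ; ,-injectiveʳ)
open import Data.Rational.Base as ℚ using (ℚ; 0ℚ; 1ℚ; ½; mkℚ)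
import Data.Rational.Properties as ℚ
open import Data.Rational.Solver using (module +-*-Solver)
import Data.Rational.Unnormalised.Base as ℚᵘ
import Data.Rational.Unnormalised.Properties as ℚᵘ
open import Data.Sum.Base as Sum using (_⊎_; inj₁; inj₂)
open import Data.Vec.Base as Vec using ([]; _∷_; here; there)
import Data.Vec.Functional as Vector
import Data.Vec.Properties as Vec
open import Function.Base using (_∘_; id)
open import Function.Bundles using (_⇔_; mk⇔; Equivalence)
open import Level using (Level)
open import Relation.Binary.Definitions using (tri<; tri≈; tri>)
open import Relation.Binary.PropositionalEquality
open import Relation.Nullary.Decidable using (Dec; does; yes; no; does-⇔; decidable-stable)
open import Relation.Nullary.Negation using (¬_; contradiction)
open import Relation.Unary using (Pred; Decidable)

open Exp (CommutativeRing.semiring ℚ.+-*-commutativeRing) using (_^_; ^-assocʳ)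
open Mult (CommutativeRing.semiring ℚ.+-*-commutativeRing) using (×-assoc-*) renaming (_×_ to _·_)

private
  variable
    k m n ℓ : ℕ
    a a′ ℓ₁ ℓ₂ : Level
    A : Set a
    B : Set a′

-- Symmetric chains and Sperner's theorem

-- The indices are the size of the ground set and one less than the number of members of the chain.
-- From a chain X₀ ⊂ … ⊂ X_ℓ, `up` makes X₀ ⊂ … ⊂ X_ℓ ⊂ X_ℓ ∪ {new} and `down` makes
-- X₀ ∪ {new} ⊂ … ⊂ X_{ℓ-1} ∪ {new}.
data Chain : ℕ → ℕ → Set where
  nil  : Chain 0 0
  up   : Chain n ℓ → Chain (suc n) (suc ℓ)
  down : Chain n (suc ℓ) → Chain (suc n) ℓ

-- The `View` is an argument of `elem-up`, so that a later split on `view i` makes `elem` reduce.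
elem : Chain n ℓ → Fin (suc ℓ) → Subset n
elem-up : Chain n ℓ → {i : Fin (suc (suc ℓ))} → View i → Subset (suc n)

elem nil      i = []
elem (up c)   i = elem-up c (view i)
elem (down c) i = inside ∷ elem c (inject₁ i)

elem-up c ‵fromℕ       = inside ∷ elem c (fromℕ _)
elem-up c (‵inject₁ i) = outside ∷ elem c i

-- Positions correspond bijectively to subsets through `locate` and `at`; this bijection is the
-- symmetric chain decomposition.
Position : ℕ → Set
Position n = Σ[ ℓ ∈ ℕ ] Chain n ℓ × Fin (suc ℓ)

-- Adjoining the new point to the top of a chain gives the top of its `up` chain; adjoining it to
-- any other member lands in the `down` chain, at the same index.
insert : Position n → Position (suc n)
-- A one-member chain has no `down` chain, and its only member is its top.
insert (zero , c , i) = 1 , up c , suc zero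
insert (suc ℓ , c , i) with view i
... | ‵fromℕ     = suc (suc ℓ) , up c , fromℕ (suc (suc ℓ))
... | ‵inject₁ j = ℓ , down c , j

locate : Subset n → Position n
locate []            = 0 , nil , zero
locate (inside ∷ x)  = insert (locate x)
locate (outside ∷ x) = let ℓ , c , i = locate x in suc ℓ , up c , inject₁ i

at : Position n → Subset n
at (_ , c , i) = elem c i

insert-fromℕ : (c : Chain n ℓ) → insert (ℓ , c , fromℕ ℓ) ≡ (suc ℓ , up c , fromℕ (suc ℓ))
insert-fromℕ {ℓ = zero}  c = refl
insert-fromℕ {ℓ = suc ℓ} c rewrite view-fromℕ (suc ℓ) = refl

insert-inject₁ : (c : Chain n (suc ℓ)) (i : Fin (suc ℓ)) →
                 insert (suc ℓ , c , inject₁ i) ≡ (ℓ , down c , i)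
insert-inject₁ c i rewrite view-inject₁ i = refl

-- Distinct positions hold distinct subsets, so no subset lies in two chains; `at-locate` adds that
-- every subset lies in one.
locate-elem : (c : Chain n ℓ) (i : Fin (suc ℓ)) → locate (elem c i) ≡ (ℓ , c , i)
locate-elem nil zero = refl
locate-elem (up c) i with view i
... | ‵fromℕ     rewrite locate-elem c (fromℕ _) = insert-fromℕ c
... | ‵inject₁ j rewrite locate-elem c j = refl
locate-elem (down c) i rewrite locate-elem c (inject₁ i) = insert-inject₁ c i

at-insert : (q : Position n) → at (insert q) ≡ inside ∷ at q
at-insert (zero , c , zero) = refl
at-insert (suc ℓ , c , i) with view i
... | ‵fromℕ rewrite view-fromℕ (suc (suc ℓ)) = refl
... | ‵inject₁ j = refl

at-locate : (x : Subset n) → at (locate x) ≡ x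
at-locate []           = refl
at-locate (inside ∷ x) = trans (at-insert (locate x)) (cong (inside ∷_) (at-locate x))
at-locate (outside ∷ x) with locate x | at-locate x
... | ℓ , c , i | eq rewrite view-inject₁ i = cong (outside ∷_) eq

elem-mono : (c : Chain n ℓ) {i j : Fin (suc ℓ)} → i Fin.≤ j → elem c i ⊆ elem c j
elem-mono nil i≤j = id
elem-mono (up c) {i} {j} i≤j with view i | view j
... | ‵fromℕ     | ‵fromℕ     = id
... | ‵inject₁ i | ‵fromℕ     = out⊆ (elem-mono c (Fin.≤fromℕ i))
... | ‵inject₁ i | ‵inject₁ j =
  s⊆s (elem-mono c (subst₂ _≤_ (Fin.toℕ-inject₁ i) (Fin.toℕ-inject₁ j) i≤j))
... | ‵fromℕ {n} | ‵inject₁ j =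
  contradiction (subst₂ _≤_ (Fin.toℕ-fromℕ n) (Fin.toℕ-inject₁ j) i≤j) (ℕ.<⇒≱ (Fin.toℕ<n j))
elem-mono (down c) {i} {j} i≤j =
  s⊆s (elem-mono c (subst₂ _≤_ (sym (Fin.toℕ-inject₁ i)) (sym (Fin.toℕ-inject₁ j)) i≤j))

elem-comparable : (c : Chain n ℓ) (i j : Fin (suc ℓ)) → elem c i ⊆ elem c j ⊎ elem c j ⊆ elem c i
elem-comparable c i j = Sum.map (elem-mono c) (elem-mono c) (Fin.≤-total i j)

bottomSize : Chain n ℓ → ℕ
bottomSize nil      = 0
bottomSize (up c)   = bottomSize c
bottomSize (down c) = suc (bottomSize c)

∣elem∣ : (c : Chain n ℓ) (i : Fin (suc ℓ)) → ∣ elem c i ∣ ≡ bottomSize c ℕ.+ toℕ i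
∣elem∣ nil zero = refl
∣elem∣ (up c) i with view i
... | ‵fromℕ     = trans (cong suc (∣elem∣ c (fromℕ _))) (sym (ℕ.+-suc (bottomSize c) _))
... | ‵inject₁ j = trans (∣elem∣ c j) (cong (bottomSize c ℕ.+_) (sym (Fin.toℕ-inject₁ j)))
∣elem∣ (down c) i =
  cong suc (trans (∣elem∣ c (inject₁ i)) (cong (bottomSize c ℕ.+_) (Fin.toℕ-inject₁ i)))

-- `up` raises the size of the largest member by one and `down` that of the smallest, while the
-- ground set grows by one; so the two extreme sizes always sum to `n`.
chain-symmetric : (c : Chain n ℓ) → bottomSize c ℕ.+ (bottomSize c ℕ.+ ℓ) ≡ n
chain-symmetric nil = refl
chain-symmetric {ℓ = suc ℓ} (up c) =
  trans (trans (cong (b ℕ.+_) (ℕ.+-suc b ℓ)) (ℕ.+-suc b (b ℕ.+ ℓ))) (cong suc (chain-symmetric c))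
  where b = bottomSize c
chain-symmetric {ℓ = ℓ} (down c) =
  cong suc (trans (cong (b ℕ.+_) (sym (ℕ.+-suc b ℓ))) (chain-symmetric c))
  where b = bottomSize c

⌊m+[m+n]/2⌋≡m+⌊n/2⌋ : ∀ m n → ⌊ m ℕ.+ (m ℕ.+ n) /2⌋ ≡ m ℕ.+ ⌊ n /2⌋
⌊m+[m+n]/2⌋≡m+⌊n/2⌋ zero    n = refl
⌊m+[m+n]/2⌋≡m+⌊n/2⌋ (suc m) n =
  trans (cong (λ l → ⌊ suc l /2⌋) (ℕ.+-suc m (m ℕ.+ n))) (cong suc (⌊m+[m+n]/2⌋≡m+⌊n/2⌋ m n))

half : ∀ ℓ → Fin (suc ℓ)
half ℓ = fromℕ< (s≤s (ℕ.⌊n/2⌋≤n ℓ))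

middle : Subset n → Subset n
middle x = let ℓ , c , _ = locate x in elem c (half ℓ)

-- By `chain-symmetric` every chain is centred at half of `n`, so its halfway index meets the middle
-- level.
∣middle∣ : (x : Subset n) → ∣ middle x ∣ ≡ ⌊ n /2⌋
∣middle∣ {n} x with ℓ , c , _ ← locate x = begin
  ∣ elem c (half ℓ) ∣                              ≡⟨ ∣elem∣ c (half ℓ) ⟩
  bottomSize c ℕ.+ toℕ (half ℓ)                    ≡⟨ cong (bottomSize c ℕ.+_) (Fin.toℕ-fromℕ< _) ⟩
  bottomSize c ℕ.+ ⌊ ℓ /2⌋                         ≡⟨ ⌊m+[m+n]/2⌋≡m+⌊n/2⌋ (bottomSize c) ℓ ⟨
  ⌊ bottomSize c ℕ.+ (bottomSize c ℕ.+ ℓ) /2⌋      ≡⟨ cong ⌊_/2⌋ (chain-symmetric c) ⟩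
  ⌊ n /2⌋                                          ∎
  where open ≡-Reasoning

-- Locating the common middle element recovers its chain, so `x` and `y` lie in one and the same
-- chain.
middle-≡⇒comparable : (x y : Subset n) → middle x ≡ middle y → x ⊆ y ⊎ y ⊆ x
middle-≡⇒comparable x y eq with locate x | at-locate x | locate y | at-locate y
... | ℓ , c , i | refl | ℓ′ , c′ , j | refl
  with refl ← trans (sym (locate-elem c (half ℓ))) (trans (cong locate eq) (locate-elem c′ (half ℓ′)))
  = elem-comparable c i j

-- Subsets of a fixed size, enumerated along Pascal's rule

subsetsOfSize : ∀ n → ℕ → List (Subset n)
subsetsOfSize zero    zero    = [] ∷ []
subsetsOfSize zero    (suc k) = []
subsetsOfSize (suc n) zero    = List.map (outside ∷_) (subsetsOfSize n zero)
subsetsOfSize (suc n) (suc k) =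
  List.map (inside ∷_) (subsetsOfSize n k) ++ List.map (outside ∷_) (subsetsOfSize n (suc k))

nC0≡1 : ∀ n → n C 0 ≡ 1
nC0≡1 n = trans (nCk≡nC[n∸k] {n = n} z≤n) (nCn≡1 n)

length-subsetsOfSize : ∀ n k → length (subsetsOfSize n k) ≡ n C k
length-subsetsOfSize zero    zero    = refl
length-subsetsOfSize zero    (suc k) = refl
length-subsetsOfSize (suc n) zero    =
  trans (length-map (outside ∷_) (subsetsOfSize n 0)) (trans (length-subsetsOfSize n 0)
    (trans (nC0≡1 n) (sym (nC0≡1 (suc n)))))
length-subsetsOfSize (suc n) (suc k) = begin
  length (List.map (inside ∷_) xs ++ List.map (outside ∷_) ys) ≡⟨ length-++ (List.map (inside ∷_) xs) ⟩
  length (List.map (inside ∷_) xs) ℕ.+ length (List.map (outside ∷_) ys)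
    ≡⟨ cong₂ ℕ._+_ (trans (length-map _ xs) (length-subsetsOfSize n k))
                   (trans (length-map _ ys) (length-subsetsOfSize n (suc k))) ⟩
  n C k ℕ.+ n C suc k ≡⟨ nCk+nC[k+1]≡[n+1]C[k+1] n k ⟩
  suc n C suc k ∎
  where
  open ≡-Reasoning
  xs = subsetsOfSize n k
  ys = subsetsOfSize n (suc k)

∈-subsetsOfSize⁺ : (x : Subset n) → ∣ x ∣ ≡ k → x List.∈ subsetsOfSize n k
∈-subsetsOfSize⁺ []            refl = here refl
∈-subsetsOfSize⁺ (inside ∷ x)  refl = ∈-++⁺ˡ (∈-map⁺ (inside ∷_) (∈-subsetsOfSize⁺ x refl))
∈-subsetsOfSize⁺ {k = zero}  (outside ∷ x) eq = ∈-map⁺ (outside ∷_) (∈-subsetsOfSize⁺ x eq)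
∈-subsetsOfSize⁺ {k = suc k} (outside ∷ x) eq =
  ∈-++⁺ʳ (List.map (inside ∷_) (subsetsOfSize _ k)) (∈-map⁺ (outside ∷_) (∈-subsetsOfSize⁺ x eq))

∈-subsetsOfSize⁻ : ∀ n k {x : Subset n} → x List.∈ subsetsOfSize n k → ∣ x ∣ ≡ k
∈-subsetsOfSize⁻ zero    zero    (here refl) = refl
∈-subsetsOfSize⁻ (suc n) zero    x∈ with _ , y∈ , refl ← ∈-map⁻ (outside ∷_) x∈ =
  ∈-subsetsOfSize⁻ n zero y∈
∈-subsetsOfSize⁻ (suc n) (suc k) x∈ with ∈-++⁻ (List.map (inside ∷_) (subsetsOfSize n k)) x∈
... | inj₁ x∈ˡ with _ , y∈ , refl ← ∈-map⁻ (inside ∷_) x∈ˡ = cong suc (∈-subsetsOfSize⁻ n k y∈)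
... | inj₂ x∈ʳ with _ , y∈ , refl ← ∈-map⁻ (outside ∷_) x∈ʳ = ∈-subsetsOfSize⁻ n (suc k) y∈

subsetsOfSize-unique : ∀ n k → Unique (subsetsOfSize n k)
subsetsOfSize-unique zero    zero    = [] ∷ []
subsetsOfSize-unique zero    (suc k) = []
subsetsOfSize-unique (suc n) zero    = Unique.map⁺ (λ { refl → refl }) (subsetsOfSize-unique n zero)
subsetsOfSize-unique (suc n) (suc k) = Unique.++⁺
  (Unique.map⁺ (λ { refl → refl }) (subsetsOfSize-unique n k))
  (Unique.map⁺ (λ { refl → refl }) (subsetsOfSize-unique n (suc k)))
  λ { (x∈ˡ , x∈ʳ) → disjoint (∈-map⁻ (inside ∷_) x∈ˡ) (∈-map⁻ (outside ∷_) x∈ʳ) }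
  where
  disjoint : ∀ {z} → ∃[ x ] (x List.∈ subsetsOfSize n k × z ≡ inside ∷ x) →
             ¬ (∃[ y ] (y List.∈ subsetsOfSize n (suc k) × z ≡ outside ∷ y))
  disjoint (_ , _ , refl) (_ , _ , ())

lookup-injective : {xs : List A} → Unique xs → ∀ i j → lookup xs i ≡ lookup xs j → i ≡ j
lookup-injective (x∉xs ∷ uniq) zero    zero    eq = refl
lookup-injective (x∉xs ∷ uniq) zero    (suc j) eq = contradiction eq (All.lookup x∉xs (∈-lookup j))
lookup-injective (x∉xs ∷ uniq) (suc i) zero    eq = contradiction (sym eq) (All.lookup x∉xs (∈-lookup i))
lookup-injective (x∉xs ∷ uniq) (suc i) (suc j) eq = cong suc (lookup-injective uniq i j eq)

-- Pigeonhole: each member is sent to its middle element, indexed in the list of the middle level.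
-- Members with the same middle element are comparable, hence equal in an antichain.
sperner : (xs : List (Subset n)) → Unique xs →
          (∀ {x y} → x List.∈ xs → y List.∈ xs → x ⊆ y → x ≡ y) →
          length xs ≤ n C ⌊ n /2⌋
sperner {n} xs uniq antichain =
  subst (length xs ≤_) (length-subsetsOfSize n ⌊ n /2⌋) (Fin.injective⇒≤ {f = f} f-injective)
  where
  ms = subsetsOfSize n ⌊ n /2⌋
  mid∈ : ∀ i → middle (lookup xs i) List.∈ ms
  mid∈ i = ∈-subsetsOfSize⁺ (middle (lookup xs i)) (∣middle∣ (lookup xs i))
  f : Fin (length xs) → Fin (length ms)
  f i = index (mid∈ i)
  f-injective : ∀ {i j} → f i ≡ f j → i ≡ j
  f-injective {i} {j} eq = lookup-injective uniq i j
    (Sum.[ antichain (∈-lookup i) (∈-lookup j) , sym ∘ antichain (∈-lookup j) (∈-lookup i) ]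
      (middle-≡⇒comparable (lookup xs i) (lookup xs j)
        (trans (lookup-index (mid∈ i)) (trans (cong (lookup ms) eq) (sym (lookup-index (mid∈ j)))))))

-- Monotonicity of clique probabilities

0≤p+q : ∀ {p q} → 0ℚ ℚ.≤ p → 0ℚ ℚ.≤ q → 0ℚ ℚ.≤ p ℚ.+ q
0≤p+q = ℚ.+-mono-≤

0≤p*q : ∀ {p q} → 0ℚ ℚ.≤ p → 0ℚ ℚ.≤ q → 0ℚ ℚ.≤ p ℚ.* q
0≤p*q {p} {q} 0≤p 0≤q = ℚ.nonNegative⁻¹ (p ℚ.* q)
  {{ℚ.nonNeg*nonNeg⇒nonNeg p {{ℚ.nonNegative 0≤p}} q {{ℚ.nonNegative 0≤q}}}}

p≤p+q : ∀ {p q} → 0ℚ ℚ.≤ q → p ℚ.≤ p ℚ.+ q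
p≤p+q {p} {q} 0≤q = subst (ℚ._≤ p ℚ.+ q) (ℚ.+-identityʳ p) (ℚ.+-monoʳ-≤ p 0≤q)

p≤∣p∣ : ∀ p → p ℚ.≤ ℚ.∣ p ∣
p≤∣p∣ p with ℚ.≤-total 0ℚ p
... | inj₁ 0≤p = ℚ.≤-reflexive (sym (ℚ.0≤p⇒∣p∣≡p 0≤p))
... | inj₂ p≤0 = ℚ.≤-trans p≤0 (ℚ.0≤∣p∣ p)

p≤q⇒0≤q-p : ∀ {p q} → p ℚ.≤ q → 0ℚ ℚ.≤ q ℚ.- p
p≤q⇒0≤q-p {p} {q} p≤q = subst (ℚ._≤ q ℚ.- p) (ℚ.+-inverseʳ p) (ℚ.+-monoˡ-≤ (ℚ.- p) p≤q)

0≤q-p⇒p≤q : ∀ {p q} → 0ℚ ℚ.≤ q ℚ.- p → p ℚ.≤ q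
0≤q-p⇒p≤q {p} {q} 0≤q-p = subst₂ ℚ._≤_ (ℚ.+-identityˡ p) (lemma p q) (ℚ.+-monoˡ-≤ p 0≤q-p)
  where
  open +-*-Solver
  lemma : ∀ p q → q ℚ.- p ℚ.+ p ≡ q
  lemma = solve 2 (λ p q → q :- p :+ p := q) refl

≤ᴿ-refl : ∀ x → x ≤ᴿ x
≤ᴿ-refl x ε 0<ε = 0 , λ i _ → p≤p+q (ℚ.<⇒≤ 0<ε)

≤ᴿ-trans : ∀ x y z → x ≤ᴿ y → y ≤ᴿ z → x ≤ᴿ z
≤ᴿ-trans x y z x≤y y≤z ε 0<ε with x≤y (½ ℚ.* ε) (½-pos 0<ε) | y≤z (½ ℚ.* ε) (½-pos 0<ε)
... | N , hx | M , hy = N ⊔ M , λ i i≥ → begin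
  seq x i                                  ≤⟨ hx i (ℕ.m⊔n≤o⇒m≤o N M i≥) ⟩
  seq y i ℚ.+ ½ ℚ.* ε                      ≤⟨ ℚ.+-monoˡ-≤ (½ ℚ.* ε) (hy i (ℕ.m⊔n≤o⇒n≤o N M i≥)) ⟩
  (seq z i ℚ.+ ½ ℚ.* ε) ℚ.+ ½ ℚ.* ε        ≡⟨ ℚ.+-assoc (seq z i) _ _ ⟩
  seq z i ℚ.+ (½ ℚ.* ε ℚ.+ ½ ℚ.* ε)        ≡⟨ cong (seq z i ℚ.+_) (½-sum ε) ⟩
  seq z i ℚ.+ ε                            ∎
  where open ℚ.≤-Reasoning

+ᴿ-mono-≤ : ∀ x y z w → x ≤ᴿ y → z ≤ᴿ w → x +ᴿ z ≤ᴿ y +ᴿ w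
+ᴿ-mono-≤ x y z w x≤y z≤w ε 0<ε with x≤y (½ ℚ.* ε) (½-pos 0<ε) | z≤w (½ ℚ.* ε) (½-pos 0<ε)
... | N , hx | M , hz = N ⊔ M , λ i i≥ → begin
  seq x i ℚ.+ seq z i
    ≤⟨ ℚ.+-mono-≤ (hx i (ℕ.m⊔n≤o⇒m≤o N M i≥)) (hz i (ℕ.m⊔n≤o⇒n≤o N M i≥)) ⟩
  (seq y i ℚ.+ ½ ℚ.* ε) ℚ.+ (seq w i ℚ.+ ½ ℚ.* ε)
    ≡⟨ rearrange (seq y i) (seq w i) (½ ℚ.* ε) ⟩
  (seq y i ℚ.+ seq w i) ℚ.+ (½ ℚ.* ε ℚ.+ ½ ℚ.* ε)
    ≡⟨ cong (seq y i ℚ.+ seq w i ℚ.+_) (½-sum ε) ⟩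
  (seq y i ℚ.+ seq w i) ℚ.+ ε ∎
  where
  open ℚ.≤-Reasoning
  open +-*-Solver
  rearrange : ∀ y w h → (y ℚ.+ h) ℚ.+ (w ℚ.+ h) ≡ (y ℚ.+ w) ℚ.+ (h ℚ.+ h)
  rearrange = solve 3 (λ y w h → (y :+ h) :+ (w :+ h) := (y :+ w) :+ (h :+ h)) refl

-- Both factors may be slightly negative. Expanding `(x + η) (y + θ) ≥ 0` and bounding `x` by `B`
-- and `y` by `D` in the cross terms leaves exactly the error `ε`.
0≤-*-step : ∀ {B D η θ ε} x y → x ℚ.≤ B → y ℚ.≤ D → 0ℚ ℚ.< η → 0ℚ ℚ.< θ →
  (B ℚ.+ η) ℚ.* θ ℚ.+ D ℚ.* η ≡ ε →
  0ℚ ℚ.≤ x ℚ.+ η → 0ℚ ℚ.≤ y ℚ.+ θ → 0ℚ ℚ.≤ x ℚ.* y ℚ.+ ε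
0≤-*-step {B} {D} {η} {θ} x y x≤B y≤D 0<η 0<θ refl 0≤x+η 0≤y+θ =
  subst (0ℚ ℚ.≤_) (split x y B D η θ)
    (0≤p+q (0≤p*q 0≤x+η 0≤y+θ)
      (0≤p+q (0≤p*q (p≤q⇒0≤q-p x≤B) (ℚ.<⇒≤ 0<θ)) (0≤p*q (p≤q⇒0≤q-p y≤D) (ℚ.<⇒≤ 0<η))))
  where
  open +-*-Solver
  split : ∀ x y B D η θ →
    (x ℚ.+ η) ℚ.* (y ℚ.+ θ) ℚ.+ ((B ℚ.- x) ℚ.* θ ℚ.+ (D ℚ.- y) ℚ.* η) ≡
    x ℚ.* y ℚ.+ ((B ℚ.+ η) ℚ.* θ ℚ.+ D ℚ.* η)
  split = solve 6 (λ x y B D η θ →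
    (x :+ η) :* (y :+ θ) :+ ((B :- x) :* θ :+ (D :- y) :* η) :=
    x :* y :+ ((B :+ η) :* θ :+ D :* η)) refl

0≤-*ᴿ : ∀ x y → 0ᴿ ≤ᴿ x → 0ᴿ ≤ᴿ y → 0ᴿ ≤ᴿ x *ᴿ y
0≤-*ᴿ x y 0≤x 0≤y ε 0<ε =
  let B , 0<B , K , x≤B = cauchy-bound (seq x) (cauchy x)
      D , 0<D , L , y≤D = cauchy-bound (seq y) (cauchy y)
      η , 0<η , Dη≡     = scale-down 0<D (½-pos 0<ε)
      -- `θ` is chosen after `η` because its coefficient in the error is `B + η`; each of the two
      -- error terms is half of `ε`.
      θ , 0<θ , Bθ≡     = scale-down (ℚ.+-mono-< 0<B 0<η) (½-pos 0<ε)
      N , hx            = 0≤x η 0<η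
      M , hy            = 0≤y θ 0<θ
  in (K ⊔ L) ⊔ (N ⊔ M) , λ i i≥ →
  let K⊔L≤i = ℕ.m⊔n≤o⇒m≤o (K ⊔ L) (N ⊔ M) i≥
      N⊔M≤i = ℕ.m⊔n≤o⇒n≤o (K ⊔ L) (N ⊔ M) i≥
  in 0≤-*-step (seq x i) (seq y i)
       (ℚ.≤-trans (p≤∣p∣ (seq x i)) (x≤B i (ℕ.m⊔n≤o⇒m≤o K L K⊔L≤i)))
       (ℚ.≤-trans (p≤∣p∣ (seq y i)) (y≤D i (ℕ.m⊔n≤o⇒n≤o K L K⊔L≤i)))
       0<η 0<θ (trans (cong₂ ℚ._+_ Bθ≡ Dη≡) (½-sum ε))
       (hx i (ℕ.m⊔n≤o⇒m≤o N M N⊔M≤i)) (hy i (ℕ.m⊔n≤o⇒n≤o N M N⊔M≤i))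

0≤∏ : (f : Fin m → ℝ) → (∀ i → 0ᴿ ≤ᴿ f i) → 0ᴿ ≤ᴿ ∏ f
0≤∏ {zero}  f 0≤f = λ ε 0<ε → 0 , λ _ _ → ℚ.<⇒≤ (ℚ.+-mono-< (ℚ.positive⁻¹ 1ℚ) 0<ε)
0≤∏ {suc m} f 0≤f = 0≤-*ᴿ (f zero) (∏ (f ∘ suc)) (0≤f zero) (0≤∏ (f ∘ suc) (0≤f ∘ suc))

∑-mono-≤ : (xs : List A) (f g : A → ℝ) → (∀ x → f x ≤ᴿ g x) → ∑ xs f ≤ᴿ ∑ xs g
∑-mono-≤ []       f g f≤g = ≤ᴿ-refl 0ᴿ
∑-mono-≤ (x ∷ xs) f g f≤g = +ᴿ-mono-≤ (f x) (g x) (∑ xs f) (∑ xs g) (f≤g x) (∑-mono-≤ xs f g f≤g)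

0<x⇒0≤x : ∀ x → 0ᴿ <ᴿ x → 0ᴿ ≤ᴿ x
0<x⇒0≤x x (δ , 0<δ , N , h) ε 0<ε = N , λ i i≥ → begin
  0ℚ            ≤⟨ ℚ.<⇒≤ 0<δ ⟩
  δ             ≡⟨ ℚ.+-identityˡ δ ⟨
  0ℚ ℚ.+ δ      ≤⟨ h i i≥ ⟩
  seq x i       ≤⟨ p≤p+q (ℚ.<⇒≤ 0<ε) ⟩
  seq x i ℚ.+ ε ∎
  where open ℚ.≤-Reasoning

x≤1⇒0≤1-x : ∀ x → x ≤ᴿ 1ᴿ → 0ᴿ ≤ᴿ 1ᴿ -ᴿ x
x≤1⇒0≤1-x x x≤1 ε 0<ε with x≤1 ε 0<ε
... | N , h = N , λ i i≥ → subst (0ℚ ℚ.≤_) (rearrange (seq x i) ε) (p≤q⇒0≤q-p (h i i≥))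
  where
  open +-*-Solver
  rearrange : ∀ x ε → 1ℚ ℚ.+ ε ℚ.- x ≡ 1ℚ ℚ.- x ℚ.+ ε
  rearrange = solve 2 (λ x ε → con 1ℚ :+ ε :- x := con 1ℚ :- x :+ ε) refl

0≤-if : ∀ b x y → 0ᴿ ≤ᴿ x → 0ᴿ ≤ᴿ y → 0ᴿ ≤ᴿ (if b then x else y)
0≤-if true  x y 0≤x 0≤y = 0≤x
0≤-if false x y 0≤x 0≤y = 0≤y

if-does-mono-≤ : {P : Set ℓ₁} {Q : Set ℓ₂} (P? : Dec P) (Q? : Dec Q) → (P → Q) →
                 ∀ x → 0ᴿ ≤ᴿ x → (if does P? then x else 0ᴿ) ≤ᴿ (if does Q? then x else 0ᴿ)
if-does-mono-≤ (yes _)  (yes _)  P→Q x 0≤x = ≤ᴿ-refl x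
if-does-mono-≤ (yes p)  (no ¬q)  P→Q x 0≤x = contradiction (P→Q p) ¬q
if-does-mono-≤ (no _)   (yes _)  P→Q x 0≤x = 0≤x
if-does-mono-≤ (no _)   (no _)   P→Q x 0≤x = ≤ᴿ-refl 0ᴿ

-- The antichain of α-maximal cliques

module _ (G : UncertainGraph n) where
  open UncertainGraph G

  0≤subgraphProb : ∀ S → 0ᴿ ≤ᴿ subgraphProb G S
  0≤subgraphProb S = 0≤∏ (λ e → if does (e ∈? S) then p e else (1ᴿ -ᴿ p e)) λ e →
    0≤-if (does (e ∈? S)) (p e) (1ᴿ -ᴿ p e) (0<x⇒0≤x (p e) (p-pos e)) (x≤1⇒0≤1-x (p e) (p≤1 e))

  -- The sums are compared subgraph by subgraph; nonnegativity of `subgraphProb` settles the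
  -- subgraphs where only `Q` holds.
  Pr-mono : {P : Pred (Subset #E) ℓ₁} {Q : Pred (Subset #E) ℓ₂} (P? : Decidable P) (Q? : Decidable Q) →
            (∀ {S} → P S → Q S) → Pr G P? ≤ᴿ Pr G Q?
  Pr-mono P? Q? P⊆Q = ∑-mono-≤ (allSubsets #E)
    (λ S → if does (P? S) then subgraphProb G S else 0ᴿ)
    (λ S → if does (Q? S) then subgraphProb G S else 0ᴿ)
    λ S → if-does-mono-≤ (P? S) (Q? S) P⊆Q (subgraphProb G S) (0≤subgraphProb S)

  clq-antitone : ∀ {M M′} → M ⊆ M′ → clq G M′ ≤ᴿ clq G M
  clq-antitone {M} {M′} M⊆M′ = Pr-mono (isClique? G M′) (isClique? G M)
    λ clique u v u∈M v∈M → clique u v (M⊆M′ u∈M) (M⊆M′ v∈M)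

  -- A vertex `v` of `M′` outside `M` would give `M ∪ ⁅ v ⁆ ⊆ M′`, an α-clique by antitonicity,
  -- against the maximality of `M`. Membership is decidable, so the refutation of `v ∉ M` yields
  -- `v ∈ M`.
  αMaximal-antichain : ∀ α {M M′} → IsαMaximalClique G α M → IsαMaximalClique G α M′ → M ⊆ M′ → M ≡ M′
  αMaximal-antichain α {M} {M′} (_ , M-maximal) (M′-clique , _) M⊆M′ = ⊆-antisym M⊆M′ M′⊆M
    where
    M′⊆M : M′ ⊆ M
    M′⊆M {v} v∈M′ = decidable-stable (v ∈? M) λ v∉M → M-maximal (v , v∉M ,
      ≤ᴿ-trans α (clq G M′) (clq G (M ∪ ⁅ v ⁆)) M′-clique (clq-antitone
        λ x∈ → Sum.[ M⊆M′ , (λ x∈⁅v⁆ → subst (_∈ M′) (sym (x∈⁅y⁆⇒x≡y v x∈⁅v⁆)) v∈M′) ] (x∈p∪q⁻ M ⁅ v ⁆ x∈)))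

  αMaximal-count≤ : ∀ α {k} → HasCount (IsαMaximalClique G α) k → k ≤ n C ⌊ n /2⌋
  αMaximal-count≤ α (xs , uniq , xs⇔ , refl) = sperner xs uniq
    λ x∈ y∈ → αMaximal-antichain α (Equivalence.to (xs⇔ _) x∈) (Equivalence.to (xs⇔ _) y∈)

-- A rational whose consecutive powers separate α

p<q⇒0<q-p : ∀ {p q} → p ℚ.< q → 0ℚ ℚ.< q ℚ.- p
p<q⇒0<q-p {p} {q} p<q = subst (ℚ._< q ℚ.- p) (ℚ.+-inverseʳ p) (ℚ.+-monoˡ-< (ℚ.- p) p<q)

0<p*q : ∀ {p q} → 0ℚ ℚ.< p → 0ℚ ℚ.< q → 0ℚ ℚ.< p ℚ.* q
0<p*q {p} {q} 0<p 0<q = ℚ.positive⁻¹ (p ℚ.* q)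
  {{ℚ.pos*pos⇒pos p {{ℚ.positive 0<p}} q {{ℚ.positive 0<q}}}}

^-pos : ∀ {q} n → 0ℚ ℚ.< q → 0ℚ ℚ.< q ^ n
^-pos zero    0<q = ℚ.positive⁻¹ 1ℚ
^-pos (suc n) 0<q = 0<p*q 0<q (^-pos n 0<q)

*-monoˡ-≤ : ∀ {p q} r → 0ℚ ℚ.≤ r → p ℚ.≤ q → r ℚ.* p ℚ.≤ r ℚ.* q
*-monoˡ-≤ r 0≤r = ℚ.*-monoˡ-≤-nonNeg r {{ℚ.nonNegative 0≤r}}

*-monoʳ-≤ : ∀ {p q} r → 0ℚ ℚ.≤ r → p ℚ.≤ q → p ℚ.* r ℚ.≤ q ℚ.* r
*-monoʳ-≤ r 0≤r = ℚ.*-monoʳ-≤-nonNeg r {{ℚ.nonNegative 0≤r}}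

^-antitone : ∀ {q m n} → 0ℚ ℚ.< q → q ℚ.≤ 1ℚ → m ≤ n → q ^ n ℚ.≤ q ^ m
^-antitone {n = zero}  0<q q≤1 z≤n = ℚ.≤-refl
^-antitone {q} {n = suc n} 0<q q≤1 z≤n = begin
  q ℚ.* q ^ n  ≤⟨ *-monoʳ-≤ (q ^ n) (ℚ.<⇒≤ (^-pos n 0<q)) q≤1 ⟩
  1ℚ ℚ.* q ^ n ≡⟨ ℚ.*-identityˡ (q ^ n) ⟩
  q ^ n        ≤⟨ ^-antitone 0<q q≤1 (z≤n {n}) ⟩
  1ℚ           ∎
  where open ℚ.≤-Reasoning
^-antitone {q} 0<q q≤1 (s≤s m≤n) = *-monoˡ-≤ q (ℚ.<⇒≤ 0<q) (^-antitone 0<q q≤1 m≤n)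

0≤n·u : ∀ {u} n → 0ℚ ℚ.≤ u → 0ℚ ℚ.≤ n · u
0≤n·u zero    0≤u = ℚ.≤-refl
0≤n·u (suc n) 0≤u = 0≤p+q 0≤u (0≤n·u n 0≤u)

-- The induction step adds the nonnegative term `n u²`, which completes the product
-- `(1 - u) (1 - n u)`.
bernoulli : ∀ {u} n → 0ℚ ℚ.≤ u → u ℚ.≤ 1ℚ → 1ℚ ℚ.- n · u ℚ.≤ (1ℚ ℚ.- u) ^ n
bernoulli zero    0≤u u≤1 = ℚ.≤-refl
bernoulli {u} (suc n) 0≤u u≤1 = begin
  1ℚ ℚ.- (u ℚ.+ n · u)                   ≤⟨ p≤p+q (0≤p*q 0≤u (0≤n·u n 0≤u)) ⟩
  1ℚ ℚ.- (u ℚ.+ n · u) ℚ.+ u ℚ.* n · u   ≡⟨ factor u (n · u) ⟩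
  (1ℚ ℚ.- u) ℚ.* (1ℚ ℚ.- n · u)          ≤⟨ *-monoˡ-≤ (1ℚ ℚ.- u) (p≤q⇒0≤q-p u≤1) (bernoulli n 0≤u u≤1) ⟩
  (1ℚ ℚ.- u) ℚ.* (1ℚ ℚ.- u) ^ n          ∎
  where
  open ℚ.≤-Reasoning
  open +-*-Solver
  factor : ∀ u v → 1ℚ ℚ.- (u ℚ.+ v) ℚ.+ u ℚ.* v ≡ (1ℚ ℚ.- u) ℚ.* (1ℚ ℚ.- v)
  factor = solve 2 (λ u v → con 1ℚ :- (u :+ v) :+ u :* v := (con 1ℚ :- u) :* (con 1ℚ :- v)) refl

-- The step rests on (1 - u)(1 + (u + v)) ≤ 1 + v.
bernoulli-decay : ∀ {u} n → 0ℚ ℚ.≤ u → u ℚ.< 1ℚ → (1ℚ ℚ.- u) ^ n ℚ.* (1ℚ ℚ.+ n · u) ℚ.≤ 1ℚ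
bernoulli-decay zero    0≤u u<1 = ℚ.≤-refl
bernoulli-decay {u} (suc n) 0≤u u<1 = begin
  (q ℚ.* q ^ n) ℚ.* (1ℚ ℚ.+ (u ℚ.+ n · u))       ≡⟨ regroup u (q ^ n) (n · u) ⟩
  q ^ n ℚ.* (1ℚ ℚ.+ n · u ℚ.- u ℚ.* (u ℚ.+ n · u)) ≤⟨ *-monoˡ-≤ (q ^ n) 0≤qⁿ (0≤q-p⇒p≤q slack) ⟩
  q ^ n ℚ.* (1ℚ ℚ.+ n · u)                       ≤⟨ bernoulli-decay n 0≤u u<1 ⟩
  1ℚ                                             ∎
  where
  open ℚ.≤-Reasoning
  open +-*-Solver
  q = 1ℚ ℚ.- u
  0≤qⁿ : 0ℚ ℚ.≤ q ^ n
  0≤qⁿ = ℚ.<⇒≤ (^-pos n (p<q⇒0<q-p u<1))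
  regroup : ∀ u x v → ((1ℚ ℚ.- u) ℚ.* x) ℚ.* (1ℚ ℚ.+ (u ℚ.+ v)) ≡
                      x ℚ.* (1ℚ ℚ.+ v ℚ.- u ℚ.* (u ℚ.+ v))
  regroup = solve 3 (λ u x v → ((con 1ℚ :- u) :* x) :* (con 1ℚ :+ (u :+ v)) :=
                               x :* (con 1ℚ :+ v :- u :* (u :+ v))) refl
  cancel : ∀ x y → y ≡ x ℚ.- (x ℚ.- y)
  cancel = solve 2 (λ x y → y := x :- (x :- y)) refl
  slack : 0ℚ ℚ.≤ 1ℚ ℚ.+ n · u ℚ.- (1ℚ ℚ.+ n · u ℚ.- u ℚ.* (u ℚ.+ n · u))
  slack = subst (0ℚ ℚ.≤_) (cancel (1ℚ ℚ.+ n · u) (u ℚ.* (u ℚ.+ n · u)))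
                (0≤p*q 0≤u (0≤p+q 0≤u (0≤n·u n 0≤u)))

-- Multiples are computed over one fixed denominator in the unnormalised rationals, where no
-- cancellation of common factors interferes.
toℚᵘ-· : ∀ n m d-1 .(c : Coprime ℤ.∣ m ∣ (suc d-1)) → ℚ.toℚᵘ (n · mkℚ m d-1 c) ℚᵘ.≃ ℚᵘ.mkℚᵘ (ℤ.+ n ℤ.* m) d-1
toℚᵘ-· zero    m d-1 c = ℚᵘ.*≡* (sym (cong (ℤ._* ℤ.+ 1) (ℤ.*-zeroˡ m)))
toℚᵘ-· (suc n) m d-1 c = begin
  ℚ.toℚᵘ (x ℚ.+ n · x)                              ≈⟨ ℚ.toℚᵘ-homo-+ x (n · x) ⟩
  ℚᵘ.mkℚᵘ m d-1 ℚᵘ.+ ℚ.toℚᵘ (n · x)                 ≈⟨ ℚᵘ.+-congʳ (ℚᵘ.mkℚᵘ m d-1) (toℚᵘ-· n m d-1 c) ⟩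
  ℚᵘ.mkℚᵘ m d-1 ℚᵘ.+ ℚᵘ.mkℚᵘ (ℤ.+ n ℤ.* m) d-1      ≈⟨ ℚᵘ.*≡* (common (ℤ.+ n) m (ℤ.+ suc d-1)) ⟩
  ℚᵘ.mkℚᵘ (ℤ.+ suc n ℤ.* m) d-1                     ∎
  where
  open ℚᵘ.≃-Reasoning
  open ℤ-Solver.+-*-Solver
  x = mkℚ m d-1 c
  common : ∀ n m d → (m ℤ.* d ℤ.+ n ℤ.* m ℤ.* d) ℤ.* d ≡ (ℤ.+ 1 ℤ.+ n) ℤ.* m ℤ.* (d ℤ.* d)
  common = solve 3 (λ n m d → (m :* d :+ n :* m :* d) :* d := (con (ℤ.+ 1) :+ n) :* m :* (d :* d)) refl

-- The denominator serves as the multiplier: it turns a positive fraction into its numerator, which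
-- is at least one.
archimedean : ∀ {x} → 0ℚ ℚ.< x → ∃[ n ] (1ℚ ℚ.≤ n · x)
archimedean {mkℚ (ℤ.+ suc m) d-1 c} 0<x = suc d-1 , ℚ.toℚᵘ-cancel-≤ (begin
  ℚ.toℚᵘ 1ℚ                                   ≤⟨ ℚᵘ.*≤* (ℤ.+≤+ bound) ⟩
  ℚᵘ.mkℚᵘ (ℤ.+ suc d-1 ℤ.* ℤ.+ suc m) d-1     ≃⟨ toℚᵘ-· (suc d-1) (ℤ.+ suc m) d-1 c ⟨
  ℚ.toℚᵘ (suc d-1 · mkℚ (ℤ.+ suc m) d-1 c)    ∎)
  where
  open ℚᵘ.≤-Reasoning
  bound : 1 ℕ.* suc d-1 ≤ suc d-1 ℕ.* suc m ℕ.* 1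
  bound = subst₂ _≤_ (sym (ℕ.*-identityˡ (suc d-1))) (sym (ℕ.*-identityʳ (suc d-1 ℕ.* suc m)))
                 (ℕ.m≤m*n (suc d-1) (suc m))
archimedean {mkℚ (ℤ.+ zero) d-1 c}  (ℚ.*<* (ℤ.+<+ ()))
archimedean {mkℚ (ℤ.-[1+ _ ]) d-1 c} (ℚ.*<* ())

-- Once `n u δ ≥ 1`, the power is at most `q ^ n (1 + n u) δ`, and `bernoulli-decay` bounds this by
-- `δ`.
^-eventually-≤ : ∀ {u δ} → 0ℚ ℚ.< u → u ℚ.< 1ℚ → 0ℚ ℚ.< δ → ∃[ n ] ((1ℚ ℚ.- u) ^ n ℚ.≤ δ)
^-eventually-≤ {u} {δ} 0<u u<1 0<δ =
  let n , 1≤n·uδ = archimedean (0<p*q 0<u 0<δ) in n , bound n 1≤n·uδ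
  where
  open ℚ.≤-Reasoning
  q = 1ℚ ℚ.- u
  bound : ∀ n → 1ℚ ℚ.≤ n · (u ℚ.* δ) → q ^ n ℚ.≤ δ
  bound n 1≤n·uδ = begin
    q ^ n                              ≡⟨ ℚ.*-identityʳ (q ^ n) ⟨
    q ^ n ℚ.* 1ℚ                       ≤⟨ *-monoˡ-≤ (q ^ n) 0≤qⁿ 1≤n·uδ ⟩
    q ^ n ℚ.* n · (u ℚ.* δ)            ≡⟨ cong (q ^ n ℚ.*_) (×-assoc-* n u δ) ⟨
    q ^ n ℚ.* (n · u ℚ.* δ)            ≤⟨ *-monoˡ-≤ (q ^ n) 0≤qⁿ (*-monoʳ-≤ δ (ℚ.<⇒≤ 0<δ) n·u≤1+n·u) ⟩
    q ^ n ℚ.* ((1ℚ ℚ.+ n · u) ℚ.* δ)   ≡⟨ ℚ.*-assoc (q ^ n) (1ℚ ℚ.+ n · u) δ ⟨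
    (q ^ n ℚ.* (1ℚ ℚ.+ n · u)) ℚ.* δ   ≤⟨ *-monoʳ-≤ δ (ℚ.<⇒≤ 0<δ) (bernoulli-decay n (ℚ.<⇒≤ 0<u) u<1) ⟩
    1ℚ ℚ.* δ                           ≡⟨ ℚ.*-identityˡ δ ⟩
    δ                                  ∎
    where
    0≤qⁿ : 0ℚ ℚ.≤ q ^ n
    0≤qⁿ = ℚ.<⇒≤ (^-pos n (p<q⇒0<q-p u<1))
    n·u≤1+n·u : n · u ℚ.≤ 1ℚ ℚ.+ n · u
    n·u≤1+n·u = subst (ℚ._≤ 1ℚ ℚ.+ n · u) (ℚ.+-identityˡ (n · u)) (ℚ.+-monoˡ-≤ (n · u) (ℚ.nonNegative⁻¹ 1ℚ))

-- The search descends from the given witness and stops at the first failure of `P`; for an upward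
-- closed `P` the result is the least crossing.
first-crossing : {P : Pred ℕ ℓ₁} → Decidable P → ¬ P 0 → ∀ n → P n → ∃[ i ] (¬ P i × P (suc i))
first-crossing P? ¬P0 zero    Pn = contradiction Pn ¬P0
first-crossing P? ¬P0 (suc n) Pn with P? n
... | yes Pn′ = first-crossing P? ¬P0 n Pn′
... | no ¬Pn′ = n , ¬Pn′ , Pn

module _ {u η r : ℚ} (b : ℕ) where

  private
    q = 1ℚ ℚ.- u

  -- Write B = suc b. Take p = q ^ j for the first j with q ^ (j B) ≤ r - η. As q ^ (B B) is still above
  -- that bound, j > B; hence j b < (j - 1) B, and p ^ b exceeds r - η by at least one factor 1 / q.
  power-separation : 0ℚ ℚ.< u → u ℚ.< 1ℚ →
    r ℚ.- η ℚ.< 1ℚ ℚ.- (suc b ℕ.* suc b) · u →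
    q ℚ.* (r ℚ.+ η) ℚ.≤ r ℚ.- η → 0ℚ ℚ.< r ℚ.- η →
    ∃[ p ] (0ℚ ℚ.< p × p ℚ.≤ 1ℚ × p ^ suc b ℚ.≤ r ℚ.- η × r ℚ.+ η ℚ.≤ p ^ b)
  power-separation 0<u u<1 r-η<1-b²u q[r+η]≤r-η 0<r-η =
    let n , qⁿ≤      = ^-eventually-≤ 0<u u<1 0<r-η
        i , ¬Pi , Pi+ = first-crossing P? ¬P0 n
                         -- `n` itself satisfies `P`, since the exponent `n (b + 1)` is at least
                         -- `n`.
                         (ℚ.≤-trans (^-antitone 0<q q≤1 (ℕ.m≤m*n n (suc b))) qⁿ≤)
    in q ^ suc i , ^-pos (suc i) 0<q , ^-antitone {m = 0} {n = suc i} 0<q q≤1 z≤n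
     , subst (ℚ._≤ r ℚ.- η) (sym (^-assocʳ q (suc i) (suc b))) Pi+
     , subst (r ℚ.+ η ℚ.≤_) (sym (^-assocʳ q (suc i) b)) (ℚ.<⇒≤ (above i ¬Pi Pi+))
    where
    P : ℕ → Set
    P j = q ^ (j ℕ.* suc b) ℚ.≤ r ℚ.- η
    P? : Decidable P
    P? j = q ^ (j ℕ.* suc b) ℚ.≤? r ℚ.- η
    0<q : 0ℚ ℚ.< q
    0<q = p<q⇒0<q-p u<1
    q≤1 : q ℚ.≤ 1ℚ
    q≤1 = 0≤q-p⇒p≤q (subst (0ℚ ℚ.≤_) (cancel u) (ℚ.<⇒≤ 0<u))
      where
      open +-*-Solver
      cancel : ∀ u → u ≡ 1ℚ ℚ.- (1ℚ ℚ.- u)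
      cancel = solve 1 (λ u → u := con 1ℚ :- (con 1ℚ :- u)) refl
    -- Bernoulli's inequality with exponent `B B`: this is where `u` must be small compared with the
    -- distance of `r` from 1.
    b²<P : r ℚ.- η ℚ.< q ^ (suc b ℕ.* suc b)
    b²<P = ℚ.<-≤-trans r-η<1-b²u (bernoulli (suc b ℕ.* suc b) (ℚ.<⇒≤ 0<u) (ℚ.<⇒≤ u<1))
    ¬P≤b : ∀ {j} → j ≤ suc b → ¬ P j
    ¬P≤b j≤b Pj = ℚ.<-irrefl refl (ℚ.<-≤-trans b²<P (ℚ.≤-trans (^-antitone 0<q q≤1 (ℕ.*-monoˡ-≤ (suc b) j≤b)) Pj))
    ¬P0 : ¬ P 0
    ¬P0 = ¬P≤b z≤n
    above : ∀ i → ¬ P i → P (suc i) → r ℚ.+ η ℚ.< q ^ (suc i ℕ.* b)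
    above i ¬Pi Pi+ = ℚ.*-cancelˡ-<-nonNeg q {{ℚ.nonNegative (ℚ.<⇒≤ 0<q)}} (begin-strict
      q ℚ.* (r ℚ.+ η)             ≤⟨ q[r+η]≤r-η ⟩
      r ℚ.- η                     <⟨ ℚ.≰⇒> ¬Pi ⟩
      q ^ (i ℕ.* suc b)           ≤⟨ ^-antitone 0<q q≤1 exponent ⟩
      q ^ suc (suc i ℕ.* b)       ∎)
      where
      open ℚ.≤-Reasoning
      b<i : suc b ≤ i
      b<i = ℕ.≮⇒≥ λ i<b → ¬P≤b i<b Pi+
      -- With `j = i + 1`: `j b + 1 = B + i b ≤ i + i b = i B`.
      exponent : suc (suc i ℕ.* b) ≤ i ℕ.* suc b
      exponent = subst (suc b ℕ.+ i ℕ.* b ≤_) (sym (ℕ.*-suc i b)) (ℕ.+-monoˡ-≤ (i ℕ.* b) b<i)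

q<p+q : ∀ {p} q → 0ℚ ℚ.< p → q ℚ.< p ℚ.+ q
q<p+q {p} q 0<p = subst (ℚ._< p ℚ.+ q) (ℚ.+-identityˡ q) (ℚ.+-monoˡ-< q 0<p)

p-q<p : ∀ p {q} → 0ℚ ℚ.< q → p ℚ.- q ℚ.< p
p-q<p p {q} 0<q = subst (p ℚ.- q ℚ.<_) (ℚ.+-identityʳ p) (ℚ.+-monoʳ-< p (ℚ.neg-antimono-< 0<q))

p+r≤q⇒p≤q-r : ∀ {p q r} → p ℚ.+ r ℚ.≤ q → p ℚ.≤ q ℚ.- r
p+r≤q⇒p≤q-r {p} {q} {r} p+r≤q = subst (ℚ._≤ q ℚ.- r) (cancel p r) (ℚ.+-monoˡ-≤ (ℚ.- r) p+r≤q)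
  where
  open +-*-Solver
  cancel : ∀ p r → p ℚ.+ r ℚ.- r ≡ p
  cancel = solve 2 (λ p r → p :+ r :- r := p) refl

-- `u` is `ε` divided by `n + 1`; the successor keeps the divisor at least one, whence `u ≤ ε`.
reciprocal-scale : ∀ n {ε} → 0ℚ ℚ.< ε → ∃[ u ] (0ℚ ℚ.< u × u ℚ.≤ ε × suc n · u ≡ ε)
reciprocal-scale n {ε} 0<ε =
  let u , 0<u , Nu≡ε = scale-down (ℚ.<-≤-trans (ℚ.positive⁻¹ 1ℚ) 1≤N) 0<ε
  in u , 0<u , subst (u ℚ.≤_) (N·u≡ε u Nu≡ε) (p≤p+q (0≤n·u n (ℚ.<⇒≤ 0<u))) , N·u≡ε u Nu≡ε
  where
  1≤N : 1ℚ ℚ.≤ suc n · 1ℚ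
  1≤N = p≤p+q (0≤n·u n (ℚ.nonNegative⁻¹ 1ℚ))
  N·u≡ε : ∀ u → suc n · 1ℚ ℚ.* u ≡ ε → suc n · u ≡ ε
  N·u≡ε u Nu≡ε =
    trans (cong (suc n ·_) (sym (ℚ.*-identityˡ u))) (trans (sym (×-assoc-* (suc n) 1ℚ u)) Nu≡ε)

module _ {δ u r η : ℚ} (0<δ : 0ℚ ℚ.< δ) (0<u : 0ℚ ℚ.< u) (u<1 : u ℚ.< 1ℚ) (δ≤r : δ ℚ.≤ r)
         (0<η : 0ℚ ℚ.< η) (η+η≡uδ : η ℚ.+ η ≡ u ℚ.* δ) where

  margin<r : 0ℚ ℚ.< r ℚ.- η
  margin<r = p<q⇒0<q-p (begin-strict
    η         <⟨ q<p+q η 0<η ⟩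
    η ℚ.+ η   ≡⟨ η+η≡uδ ⟩
    u ℚ.* δ   ≤⟨ *-monoʳ-≤ δ (ℚ.<⇒≤ 0<δ) (ℚ.<⇒≤ u<1) ⟩
    1ℚ ℚ.* δ  ≡⟨ ℚ.*-identityˡ δ ⟩
    δ         ≤⟨ δ≤r ⟩
    r         ∎)
    where open ℚ.≤-Reasoning

  -- The difference of the two sides is `u r + u η - 2 η`, and `2 η = u δ` turns it into
  -- `u (r - δ) + u η`. So one factor `1 - u` carries `r + η` below `r - η`.
  margin-contracts : (1ℚ ℚ.- u) ℚ.* (r ℚ.+ η) ℚ.≤ r ℚ.- η
  margin-contracts = 0≤q-p⇒p≤q (subst (0ℚ ℚ.≤_) regroup
    (0≤p+q (0≤p*q (ℚ.<⇒≤ 0<u) (p≤q⇒0≤q-p δ≤r)) (0≤p*q (ℚ.<⇒≤ 0<u) (ℚ.<⇒≤ 0<η))))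
    where
    open ≡-Reasoning
    open +-*-Solver
    expand : ∀ u r d η → u ℚ.* (r ℚ.- d) ℚ.+ u ℚ.* η ≡ u ℚ.* r ℚ.+ u ℚ.* η ℚ.- u ℚ.* d
    expand = solve 4 (λ u r d η → u :* (r :- d) :+ u :* η := u :* r :+ u :* η :- u :* d) refl
    collect : ∀ u r η → u ℚ.* r ℚ.+ u ℚ.* η ℚ.- (η ℚ.+ η) ≡ r ℚ.- η ℚ.- (1ℚ ℚ.- u) ℚ.* (r ℚ.+ η)
    collect = solve 3 (λ u r η → u :* r :+ u :* η :- (η :+ η) :=
                                 r :- η :- (con 1ℚ :- u) :* (r :+ η)) refl
    regroup : u ℚ.* (r ℚ.- δ) ℚ.+ u ℚ.* η ≡ r ℚ.- η ℚ.- (1ℚ ℚ.- u) ℚ.* (r ℚ.+ η)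
    regroup = begin
      u ℚ.* (r ℚ.- δ) ℚ.+ u ℚ.* η               ≡⟨ expand u r δ η ⟩
      u ℚ.* r ℚ.+ u ℚ.* η ℚ.- u ℚ.* δ           ≡⟨ cong (λ x → u ℚ.* r ℚ.+ u ℚ.* η ℚ.- x) η+η≡uδ ⟨
      u ℚ.* r ℚ.+ u ℚ.* η ℚ.- (η ℚ.+ η)         ≡⟨ collect u r η ⟩
      r ℚ.- η ℚ.- (1ℚ ℚ.- u) ℚ.* (r ℚ.+ η)      ∎

-- With edge probability `p`, sets spanning at most `b` edges of a complete graph are α-cliques, and
-- sets spanning more are not.
Separates : ℝ → ℕ → ℚ → Set
Separates α b p = 0ℚ ℚ.< p × p ℚ.≤ 1ℚ × fromℚ (p ^ suc b) <ᴿ α × α ≤ᴿ fromℚ (p ^ b)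

-- The rational `r = seq α N` stands in for `α`, with accuracy `θ` from stage `N` on. The constants
-- descend from the bounds `δ` on `r` and `ε` on `1 - r`: `u = ε / (b + 1)²`, `η = u δ / 2` and
-- `θ = η / 2`.
module _ (α : ℝ) (b : ℕ) {N : ℕ} {δ ε u η θ : ℚ}
  (0<δ : 0ℚ ℚ.< δ) (δ≤r : δ ℚ.≤ seq α N) (r+ε≤1 : seq α N ℚ.+ ε ℚ.≤ 1ℚ)
  (0<u : 0ℚ ℚ.< u) (u≤ε : u ℚ.≤ ε) (b²u≡ε : (suc b ℕ.* suc b) · u ≡ ε)
  (0<η : 0ℚ ℚ.< η) (η+η≡uδ : η ℚ.+ η ≡ u ℚ.* δ)
  (0<θ : 0ℚ ℚ.< θ) (θ+θ≡η : θ ℚ.+ θ ≡ η)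
  (near : ∀ i → N ≤ i → ℚ.∣ seq α N ℚ.- seq α i ∣ ℚ.< θ) where

  private
    open ℚ.≤-Reasoning
    r : ℚ
    r = seq α N
    u<1 : u ℚ.< 1ℚ
    u<1 = begin-strict
      u        ≤⟨ u≤ε ⟩
      ε        <⟨ q<p+q ε (ℚ.<-≤-trans 0<δ δ≤r) ⟩
      r ℚ.+ ε  ≤⟨ r+ε≤1 ⟩
      1ℚ       ∎
    r-η<1-b²u : r ℚ.- η ℚ.< 1ℚ ℚ.- (suc b ℕ.* suc b) · u
    r-η<1-b²u = subst (λ x → r ℚ.- η ℚ.< 1ℚ ℚ.- x) (sym b²u≡ε)
      (ℚ.<-≤-trans (p-q<p r 0<η) (p+r≤q⇒p≤q-r r+ε≤1))
    -- Since `η = 2 θ`, a distance below `θ` from `r` still leaves room `θ` above `r - η`; this room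
    -- witnesses the strict inequality of reals.
    lower : ∀ i → N ≤ i → r ℚ.- η ℚ.+ θ ℚ.≤ seq α i
    lower i N≤i = 0≤q-p⇒p≤q (subst (0ℚ ℚ.≤_)
      (trans (rearrange r (seq α i) θ) (cong (λ x → seq α i ℚ.- (r ℚ.- x ℚ.+ θ)) θ+θ≡η))
      (p≤q⇒0≤q-p (ℚ.≤-trans (p≤∣p∣ (r ℚ.- seq α i)) (ℚ.<⇒≤ (near i N≤i)))))
      where
      open +-*-Solver
      rearrange : ∀ r x θ → θ ℚ.- (r ℚ.- x) ≡ x ℚ.- (r ℚ.- (θ ℚ.+ θ) ℚ.+ θ)
      rearrange = solve 3 (λ r x θ → θ :- (r :- x) := x :- (r :- (θ :+ θ) :+ θ)) refl
    upper : ∀ i → N ≤ i → seq α i ℚ.≤ r ℚ.+ η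
    upper i N≤i = begin
      seq α i                          ≡⟨ rearrange r (seq α i) ⟩
      r ℚ.+ ℚ.- (r ℚ.- seq α i)        ≤⟨ ℚ.+-monoʳ-≤ r (p≤∣p∣ (ℚ.- (r ℚ.- seq α i))) ⟩
      r ℚ.+ ℚ.∣ ℚ.- (r ℚ.- seq α i) ∣  ≡⟨ cong (r ℚ.+_) (ℚ.∣-p∣≡∣p∣ (r ℚ.- seq α i)) ⟩
      r ℚ.+ ℚ.∣ r ℚ.- seq α i ∣        ≤⟨ ℚ.+-monoʳ-≤ r (ℚ.<⇒≤ (near i N≤i)) ⟩
      r ℚ.+ θ                          ≤⟨ ℚ.+-monoʳ-≤ r (p≤p+q (ℚ.<⇒≤ 0<θ)) ⟩
      r ℚ.+ (θ ℚ.+ θ)                  ≡⟨ cong (r ℚ.+_) θ+θ≡η ⟩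
      r ℚ.+ η                          ∎
      where
      open +-*-Solver
      rearrange : ∀ r x → x ≡ r ℚ.+ ℚ.- (r ℚ.- x)
      rearrange = solve 2 (λ r x → x := r :+ :- (r :- x)) refl

  separates-near : ∃[ p ] Separates α b p
  separates-near =
    let p , 0<p , p≤1 , pᵇ⁺¹≤r-η , r+η≤pᵇ = power-separation {u} {η} {r} b 0<u u<1 r-η<1-b²u
          (margin-contracts 0<δ 0<u u<1 δ≤r 0<η η+η≡uδ) (margin<r 0<δ 0<u u<1 δ≤r 0<η η+η≡uδ)
    in p , 0<p , p≤1
     , (θ , 0<θ , N , λ i N≤i → ℚ.≤-trans (ℚ.+-monoˡ-≤ θ pᵇ⁺¹≤r-η) (lower i N≤i))
     , λ ε′ 0<ε′ → N , λ i N≤i → ℚ.≤-trans (upper i N≤i) (ℚ.≤-trans r+η≤pᵇ (p≤p+q (ℚ.<⇒≤ 0<ε′)))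

real-power-separation : ∀ α b → 0ᴿ <ᴿ α → α <ᴿ 1ᴿ → ∃[ p ] Separates α b p
real-power-separation α b (δ , 0<δ , K , δ≤α) (ε , 0<ε , L , α+ε≤1) =
  -- The argument is `(b + 1)² - 1`, as `reciprocal-scale` divides by the successor.
  let u , 0<u , u≤ε , b²u≡ε = reciprocal-scale (b ℕ.+ b ℕ.* suc b) 0<ε
      0<uδ = 0<p*q 0<u 0<δ
      M , close = cauchy α (½ ℚ.* (½ ℚ.* (u ℚ.* δ))) (½-pos (½-pos 0<uδ))
      N = (K ⊔ L) ⊔ M
      M≤N = ℕ.m≤n⊔m (K ⊔ L) M
  in separates-near α b {N} 0<δ
       (subst (ℚ._≤ seq α N) (ℚ.+-identityˡ δ) (δ≤α N (ℕ.≤-trans (ℕ.m≤m⊔n K L) (ℕ.m≤m⊔n (K ⊔ L) M))))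
       (α+ε≤1 N (ℕ.≤-trans (ℕ.m≤n⊔m K L) (ℕ.m≤m⊔n (K ⊔ L) M)))
       0<u u≤ε b²u≡ε (½-pos 0<uδ) (½-sum (u ℚ.* δ))
       (½-pos (½-pos 0<uδ)) (½-sum (½ ℚ.* (u ℚ.* δ)))
       (λ i N≤i → close N i M≤N (ℕ.≤-trans M≤N N≤i))

-- The complete graph with constant edge probability

-- This is `n` choose 2, in the recursive form that splits off the edges at the first vertex.
edgeCount : ℕ → ℕ
edgeCount zero    = 0
edgeCount (suc n) = n ℕ.+ edgeCount n

endpoints-split : (Fin (edgeCount n) → Fin n × Fin n) → Fin n ⊎ Fin (edgeCount n) → Fin (suc n) × Fin (suc n)
endpoints-split f (inj₁ v) = zero , suc v
endpoints-split f (inj₂ e) = Product.map suc suc (f e)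

endpoints : ∀ n → Fin (edgeCount n) → Fin n × Fin n
endpoints (suc n) e = endpoints-split (endpoints n) (splitAt n e)

-- Storing every edge with its smaller end first excludes loops, and in `simple` it rules out two
-- edges with swapped ends.
endpoints-< : ∀ n e → proj₁ (endpoints n e) Fin.< proj₂ (endpoints n e)
endpoints-< (suc n) e with splitAt n e
... | inj₁ v  = s≤s z≤n
... | inj₂ e′ = s≤s (endpoints-< n e′)

splitAt-injective : ∀ m {n} {i j : Fin (m ℕ.+ n)} → splitAt m i ≡ splitAt m j → i ≡ j
splitAt-injective m {n} {i} {j} eq =
  trans (sym (Fin.join-splitAt m n i)) (trans (cong (join m n) eq) (Fin.join-splitAt m n j))

endpoints-split-injective : {f : Fin (edgeCount n) → Fin n × Fin n} → (∀ {e e′} → f e ≡ f e′ → e ≡ e′) →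
  ∀ {s s′} → endpoints-split f s ≡ endpoints-split f s′ → s ≡ s′
endpoints-split-injective f-inj {inj₁ v} {inj₁ w}  eq = cong inj₁ (Fin.suc-injective (,-injectiveʳ eq))
endpoints-split-injective f-inj {inj₁ v} {inj₂ e}  ()
endpoints-split-injective f-inj {inj₂ e} {inj₁ v}  ()
endpoints-split-injective f-inj {inj₂ e} {inj₂ e′} eq = cong inj₂ (f-inj (cong₂ _,_
  (Fin.suc-injective (,-injectiveˡ eq)) (Fin.suc-injective (,-injectiveʳ eq))))

endpoints-injective : ∀ n {e e′} → endpoints n e ≡ endpoints n e′ → e ≡ e′
endpoints-injective (suc n) eq = splitAt-injective n (endpoints-split-injective (endpoints-injective n) eq)

endpoints-surjective : ∀ n u v → u Fin.< v → ∃[ e ] endpoints n e ≡ (u , v)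
endpoints-surjective (suc n) zero (suc v) _ =
  v ↑ˡ edgeCount n , cong (endpoints-split (endpoints n)) (Fin.splitAt-↑ˡ n v (edgeCount n))
endpoints-surjective (suc n) (suc u) (suc v) (s≤s u<v) =
  let e , eq = endpoints-surjective n u v u<v in
  n ↑ʳ e , trans (cong (endpoints-split (endpoints n)) (Fin.splitAt-↑ʳ n (edgeCount n) e))
                 (cong (Product.map suc suc) eq)

completeGraph : ∀ n (q : ℚ) → 0ℚ ℚ.< q → q ℚ.≤ 1ℚ → UncertainGraph n
completeGraph n q 0<q q≤1 = record
  { #E       = edgeCount n
  ; ends     = endpoints n
  ; loopless = λ e v → Sum.[ loopless e v , loopless e v ]
  ; simple   = simple
  ; p        = λ _ → fromℚ q
  ; p-pos    = λ _ → q , 0<q , 0 , λ _ _ → ℚ.≤-reflexive (ℚ.+-identityˡ q)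
  ; p≤1      = λ _ ε 0<ε → 0 , λ _ _ → ℚ.≤-trans q≤1 (p≤p+q (ℚ.<⇒≤ 0<ε))
  }
  where
  ordered : ∀ {e u v} → endpoints n e ≡ (u , v) → u Fin.< v
  ordered {e} eq = subst (uncurry Fin._<_) eq (endpoints-< n e)
  loopless : ∀ e v → ¬ endpoints n e ≡ (v , v)
  loopless e v eq = Fin.<-irrefl refl (ordered eq)
  simple : ∀ e e′ u v → endpoints n e ≡ (u , v) ⊎ endpoints n e ≡ (v , u) →
           endpoints n e′ ≡ (u , v) ⊎ endpoints n e′ ≡ (v , u) → e ≡ e′
  simple e e′ u v (inj₁ eq) (inj₁ eq′) = endpoints-injective n (trans eq (sym eq′))
  simple e e′ u v (inj₁ eq) (inj₂ eq′) = contradiction (ordered eq′) (Fin.<-asym (ordered eq))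
  simple e e′ u v (inj₂ eq) (inj₁ eq′) = contradiction (ordered eq′) (Fin.<-asym (ordered eq))
  simple e e′ u v (inj₂ eq) (inj₂ eq′) = endpoints-injective n (trans eq (sym eq′))

-- The recursion follows `endpoints`: the edges at the first vertex are indexed by their other end,
-- so those inside the set are selected by `M` itself, or by `⊥` if the first vertex is left out.
edgesWithin : Subset n → Subset (edgeCount n)
edgesWithin []            = []
edgesWithin (inside ∷ M)  = M Vec.++ edgesWithin M
edgesWithin (outside ∷ M) = ⊥ Vec.++ edgesWithin M

∣++∣ : (M : Subset m) (M′ : Subset n) → ∣ M Vec.++ M′ ∣ ≡ ∣ M ∣ ℕ.+ ∣ M′ ∣
∣++∣ []            M′ = refl
∣++∣ (inside ∷ M)  M′ = cong suc (∣++∣ M M′)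
∣++∣ (outside ∷ M) M′ = ∣++∣ M M′

∣edgesWithin∣ : (M : Subset n) → ∣ edgesWithin M ∣ ≡ edgeCount ∣ M ∣
∣edgesWithin∣ []            = refl
∣edgesWithin∣ (inside ∷ M)  = trans (∣++∣ M (edgesWithin M)) (cong (∣ M ∣ ℕ.+_) (∣edgesWithin∣ M))
∣edgesWithin∣ {suc n} (outside ∷ M) =
  trans (∣++∣ (⊥ {n}) (edgesWithin M)) (cong₂ ℕ._+_ (∣⊥∣≡0 n) (∣edgesWithin∣ M))

lookup-edgesWithin : (M : Subset n) (e : Fin (edgeCount n)) →
  Vec.lookup (edgesWithin M) e ≡ Vec.lookup M (proj₁ (endpoints n e)) ∧ Vec.lookup M (proj₂ (endpoints n e))
lookup-edgesWithin {suc n} (inside ∷ M) e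
  rewrite Vec.lookup-splitAt n M (edgesWithin M) e with splitAt n e
... | inj₁ v  = refl
... | inj₂ e′ = lookup-edgesWithin M e′
lookup-edgesWithin {suc n} (outside ∷ M) e
  rewrite Vec.lookup-splitAt n ⊥ (edgesWithin M) e with splitAt n e
... | inj₁ v  = Vec.lookup-replicate v outside
... | inj₂ e′ = lookup-edgesWithin M e′

∧-≡-true : ∀ {x y} → x ∧ y ≡ true → x ≡ true × y ≡ true
∧-≡-true {true} {true} refl = refl , refl

∈-edgesWithin⁺ : (M : Subset n) {e : Fin (edgeCount n)} →
  proj₁ (endpoints n e) ∈ M → proj₂ (endpoints n e) ∈ M → e ∈ edgesWithin M
∈-edgesWithin⁺ {n} M {e} u∈M v∈M = Vec.lookup⇒[]= e (edgesWithin M)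
  (trans (lookup-edgesWithin M e) (cong₂ _∧_ (Vec.[]=⇒lookup u∈M) (Vec.[]=⇒lookup v∈M)))

∈-edgesWithin⁻ : (M : Subset n) {e : Fin (edgeCount n)} → e ∈ edgesWithin M →
  proj₁ (endpoints n e) ∈ M × proj₂ (endpoints n e) ∈ M
∈-edgesWithin⁻ M {e} e∈ = Product.map (Vec.lookup⇒[]= _ M) (Vec.lookup⇒[]= _ M)
  (∧-≡-true (trans (sym (lookup-edgesWithin M e)) (Vec.[]=⇒lookup e∈)))

-- The probability that a given edge set is present

sum : List A → (A → ℚ) → ℚ
sum xs f = List.foldr ℚ._+_ 0ℚ (List.map f xs)

-- Real operations act index by index, so at a fixed index a probability becomes a finite
-- computation with rationals.
seq-∑ : (xs : List A) (f : A → ℝ) (g : A → ℚ) (i : ℕ) → (∀ x → seq (f x) i ≡ g x) → seq (∑ xs f) i ≡ sum xs g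
seq-∑ []       f g i f≡g = refl
seq-∑ (x ∷ xs) f g i f≡g = cong₂ ℚ._+_ (f≡g x) (seq-∑ xs f g i f≡g)

sum-cong : (xs : List A) {f g : A → ℚ} → (∀ x → f x ≡ g x) → sum xs f ≡ sum xs g
sum-cong []       f≡g = refl
sum-cong (x ∷ xs) f≡g = cong₂ ℚ._+_ (f≡g x) (sum-cong xs f≡g)

sum-++ : (xs ys : List A) (f : A → ℚ) → sum (xs ++ ys) f ≡ sum xs f ℚ.+ sum ys f
sum-++ []       ys f = sym (ℚ.+-identityˡ (sum ys f))
sum-++ (x ∷ xs) ys f = trans (cong (f x ℚ.+_) (sum-++ xs ys f)) (sym (ℚ.+-assoc (f x) (sum xs f) (sum ys f)))

sum-map : (h : A → B) (xs : List A) (f : B → ℚ) → sum (List.map h xs) f ≡ sum xs (f ∘ h)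
sum-map h []       f = refl
sum-map h (x ∷ xs) f = cong (f (h x) ℚ.+_) (sum-map h xs f)

sum-*ˡ : ∀ c (xs : List A) (f : A → ℚ) → sum xs (λ x → c ℚ.* f x) ≡ c ℚ.* sum xs f
sum-*ˡ c []       f = sym (ℚ.*-zeroʳ c)
sum-*ˡ c (x ∷ xs) f = trans (cong (c ℚ.* f x ℚ.+_) (sum-*ˡ c xs f)) (sym (ℚ.*-distribˡ-+ c (f x) (sum xs f)))

if-*ˡ : ∀ c b x → (if b then c ℚ.* x else 0ℚ) ≡ c ℚ.* (if b then x else 0ℚ)
if-*ˡ c true  x = refl
if-*ˡ c false x = sym (ℚ.*-zeroʳ c)

seq-if : ∀ b (x y : ℝ) i → seq (if b then x else y) i ≡ (if b then seq x i else seq y i)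
seq-if true  x y i = refl
seq-if false x y i = refl

product : (Fin m → ℚ) → ℚ
product = Vector.foldr ℚ._*_ 1ℚ

seq-∏ : (f : Fin m → ℝ) (g : Fin m → ℚ) (i : ℕ) → (∀ e → seq (f e) i ≡ g e) → seq (∏ f) i ≡ product g
seq-∏ {zero}  f g i f≡g = refl
seq-∏ {suc m} f g i f≡g = cong₂ ℚ._*_ (f≡g zero) (seq-∏ (f ∘ suc) (g ∘ suc) i (f≡g ∘ suc))

-- q̄ stands for 1 - q; as a variable it keeps the rational subtraction from being unfolded.
weight : ℚ → ℚ → Subset m → ℚ
weight q q̄ S = product λ e → if does (e ∈? S) then q else q̄

module _ {q q̄ : ℚ} (1-q≡q̄ : 1ℚ ℚ.- q ≡ q̄) where

  private
    superset-weight : Subset m → Subset m → ℚ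
    superset-weight F S = if does (F ⊆? S) then weight q q̄ S else 0ℚ

  -- Independence, edge by edge: a required edge contributes the factor `q`, a free one the factor
  -- `q + q̄ = 1`.
  sum-superset-weight : (F : Subset m) →
    sum (allSubsets m) (λ S → if does (F ⊆? S) then weight q q̄ S else 0ℚ) ≡ q ^ ∣ F ∣
  sum-superset-weight [] = refl
  sum-superset-weight {suc m} (inside ∷ F) = begin
    sum (List.map (inside ∷_) Ss ++ List.map (outside ∷_) Ss) (superset-weight (inside ∷ F))
      ≡⟨ sum-++ (List.map (inside ∷_) Ss) (List.map (outside ∷_) Ss) (superset-weight (inside ∷ F)) ⟩
    sum (List.map (inside ∷_) Ss) (superset-weight (inside ∷ F)) ℚ.+
    sum (List.map (outside ∷_) Ss) (superset-weight (inside ∷ F))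
      ≡⟨ cong₂ ℚ._+_
           (trans (sum-map (inside ∷_) Ss (superset-weight (inside ∷ F)))
             (trans (sum-cong Ss λ S → if-*ˡ q (does (F ⊆? S)) (weight q q̄ S)) (sum-*ˡ q Ss (superset-weight F))))
           (trans (sum-map (outside ∷_) Ss (superset-weight (inside ∷ F)))
             -- Subgraphs missing the required edge contribute nothing; writing each term as
             -- `0ℚ * 0ℚ` lets `sum-*ˡ` pull out the zero.
             (trans (sum-cong Ss λ S → sym (ℚ.*-zeroˡ 0ℚ)) (trans (sum-*ˡ 0ℚ Ss (λ _ → 0ℚ)) (ℚ.*-zeroˡ (sum Ss λ _ → 0ℚ))))) ⟩
    q ℚ.* sum Ss (superset-weight F) ℚ.+ 0ℚ
      ≡⟨ ℚ.+-identityʳ (q ℚ.* sum Ss (superset-weight F)) ⟩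
    q ℚ.* sum Ss (superset-weight F)
      ≡⟨ cong (q ℚ.*_) (sum-superset-weight F) ⟩
    q ℚ.* q ^ ∣ F ∣ ∎
    where
    open ≡-Reasoning
    Ss = allSubsets m
  sum-superset-weight {suc m} (outside ∷ F) = begin
    sum (List.map (inside ∷_) Ss ++ List.map (outside ∷_) Ss) (superset-weight (outside ∷ F))
      ≡⟨ sum-++ (List.map (inside ∷_) Ss) (List.map (outside ∷_) Ss) (superset-weight (outside ∷ F)) ⟩
    sum (List.map (inside ∷_) Ss) (superset-weight (outside ∷ F)) ℚ.+
    sum (List.map (outside ∷_) Ss) (superset-weight (outside ∷ F))
      ≡⟨ cong₂ ℚ._+_
           (trans (sum-map (inside ∷_) Ss (superset-weight (outside ∷ F)))
             (trans (sum-cong Ss λ S → if-*ˡ q (does (F ⊆? S)) (weight q q̄ S)) (sum-*ˡ q Ss (superset-weight F))))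
           (trans (sum-map (outside ∷_) Ss (superset-weight (outside ∷ F)))
             (trans (sum-cong Ss λ S → if-*ˡ q̄ (does (F ⊆? S)) (weight q q̄ S)) (sum-*ˡ q̄ Ss (superset-weight F)))) ⟩
    q ℚ.* sum Ss (superset-weight F) ℚ.+ q̄ ℚ.* sum Ss (superset-weight F)
      ≡⟨ cong (λ x → q ℚ.* sum Ss (superset-weight F) ℚ.+ x ℚ.* sum Ss (superset-weight F)) 1-q≡q̄ ⟨
    q ℚ.* sum Ss (superset-weight F) ℚ.+ (1ℚ ℚ.- q) ℚ.* sum Ss (superset-weight F)
      ≡⟨ total q (sum Ss (superset-weight F)) ⟩
    sum Ss (superset-weight F)
      ≡⟨ sum-superset-weight F ⟩
    q ^ ∣ F ∣ ∎
    where
    open ≡-Reasoning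
    open +-*-Solver
    Ss = allSubsets m
    total : ∀ q x → q ℚ.* x ℚ.+ (1ℚ ℚ.- q) ℚ.* x ≡ x
    total = solve 2 (λ q x → q :* x :+ (con 1ℚ :- q) :* x := x) refl

module _ (G : UncertainGraph n) {q q̄ : ℚ} {i : ℕ} where
  open UncertainGraph G

  module _ (p≡q : ∀ e → seq (p e) i ≡ q) (1-q≡q̄ : 1ℚ ℚ.- q ≡ q̄) where

    seq-subgraphProb : ∀ S → seq (subgraphProb G S) i ≡ weight q q̄ S
    seq-subgraphProb S = seq-∏ (λ e → if does (e ∈? S) then p e else (1ᴿ -ᴿ p e)) _ i λ e →
      trans (seq-if (does (e ∈? S)) (p e) (1ᴿ -ᴿ p e) i)
            (cong₂ (λ x y → if does (e ∈? S) then x else y) (p≡q e)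
                   (trans (cong (λ x → 1ℚ ℚ.- x) (p≡q e)) 1-q≡q̄))

    -- An event that amounts to the presence of all edges of `F` reduces to the superset sum, since
    -- equivalent propositions have equal decisions.
    seq-Pr : {P : Subset #E → Set} (P? : ∀ S → Dec (P S)) (F : Subset #E) → (∀ S → P S ⇔ F ⊆ S) →
             seq (Pr G P?) i ≡ q ^ ∣ F ∣
    seq-Pr P? F P⇔F⊆ = trans
      (seq-∑ (allSubsets #E) (λ S → if does (P? S) then subgraphProb G S else 0ᴿ)
        (λ S → if does (F ⊆? S) then weight q q̄ S else 0ℚ) i λ S →
        trans (seq-if (does (P? S)) (subgraphProb G S) 0ᴿ i)
              (cong₂ (λ b x → if b then x else 0ℚ) (does-⇔ (P⇔F⊆ S) (P? S) (F ⊆? S)) (seq-subgraphProb S)))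
      (sum-superset-weight 1-q≡q̄ F)

-- Cliques of the complete graph are governed by size

∣M∪⁅v⁆∣ : (M : Subset n) {v : Fin n} → v ∉ M → ∣ M ∪ ⁅ v ⁆ ∣ ≡ suc ∣ M ∣
∣M∪⁅v⁆∣ (inside ∷ M)  {zero}  v∉M = contradiction here v∉M
∣M∪⁅v⁆∣ (outside ∷ M) {zero}  v∉M = cong (suc ∘ ∣_∣) (∪-identityʳ M)
∣M∪⁅v⁆∣ (inside ∷ M)  {suc v} v∉M = cong suc (∣M∪⁅v⁆∣ M (v∉M ∘ there))
∣M∪⁅v⁆∣ (outside ∷ M) {suc v} v∉M = ∣M∪⁅v⁆∣ M (v∉M ∘ there)

∣M∣<n⇒∃v∉M : (M : Subset n) → ∣ M ∣ < n → ∃[ v ] v ∉ M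
∣M∣<n⇒∃v∉M {n} M ∣M∣<n with nonempty? (∁ M)
... | yes (v , v∈∁M) = v , x∈∁p⇒x∉p v∈∁M
... | no  ∁M-empty   = contradiction
  (trans (sym (∣∁p∣≡n∸∣p∣ M)) (trans (cong ∣_∣ (Empty-unique ∁M-empty)) (∣⊥∣≡0 n)))
  (ℕ.m>n⇒m∸n≢0 ∣M∣<n)

edgeCount-mono : ∀ {m n} → m ≤ n → edgeCount m ≤ edgeCount n
edgeCount-mono z≤n       = z≤n
edgeCount-mono (s≤s m≤n) = ℕ.+-mono-≤ m≤n (edgeCount-mono m≤n)

module _ {n : ℕ} {q : ℚ} (0<q : 0ℚ ℚ.< q) (q≤1 : q ℚ.≤ 1ℚ) where

  private
    G : UncertainGraph n
    G = completeGraph n q 0<q q≤1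
  open UncertainGraph G using (simple)

  -- Every pair of distinct vertices is joined by exactly one edge: `endpoints-surjective` supplies
  -- it, and `simple` identifies the edge found by the clique condition with the given one.
  isClique⇔edgesWithin⊆ : ∀ M S → IsClique G M S ⇔ edgesWithin M ⊆ S
  isClique⇔edgesWithin⊆ M S = mk⇔ to from
    where
    to : IsClique G M S → edgesWithin M ⊆ S
    to clique {e} e∈ =
      let u∈M , v∈M            = ∈-edgesWithin⁻ M e∈
          e′ , e′∈S , e′-joins = clique _ _ u∈M v∈M (Fin.<⇒≢ (endpoints-< n e))
      in subst (_∈ S) (simple e′ e _ _ e′-joins (inj₁ refl)) e′∈S
    from : edgesWithin M ⊆ S → IsClique G M S
    from ⊆S u v u∈M v∈M u≢v with Fin.<-cmp u v
    ... | tri< u<v _ _ with e , refl ← endpoints-surjective n u v u<v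
      = e , ⊆S (∈-edgesWithin⁺ M u∈M v∈M) , inj₁ refl
    ... | tri≈ _ u≡v _ = contradiction u≡v u≢v
    ... | tri> _ _ v<u with e , refl ← endpoints-surjective n v u v<u
      = e , ⊆S (∈-edgesWithin⁺ M v∈M u∈M) , inj₂ refl

  seq-clq : ∀ M i → seq (clq G M) i ≡ q ^ edgeCount ∣ M ∣
  seq-clq M i = begin
    seq (clq G M) i       ≡⟨ seq-Pr G (λ _ → refl) refl (isClique? G M) (edgesWithin M) (isClique⇔edgesWithin⊆ M) ⟩
    q ^ ∣ edgesWithin M ∣ ≡⟨ cong (q ^_) (∣edgesWithin∣ M) ⟩
    q ^ edgeCount ∣ M ∣   ∎
    where open ≡-Reasoning

  -- The exponent `b` lies between the edge counts of `k` and `k + 1` vertices, the latter excluded;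
  -- so the threshold between `q ^ b` and `q ^ suc b` is a threshold between the sizes `k` and
  -- `k + 1`.
  module _ {α : ℝ} {k b : ℕ} (edges-k≤b : edgeCount k ≤ b) (b<edges-k+1 : suc b ≤ edgeCount (suc k))
           (pᵇ⁺¹<α : fromℚ (q ^ suc b) <ᴿ α) (α≤pᵇ : α ≤ᴿ fromℚ (q ^ b)) where

    ∣M∣≤k⇒αClique : ∀ M → ∣ M ∣ ≤ k → IsαClique G α M
    ∣M∣≤k⇒αClique M ∣M∣≤k ε 0<ε =
      let N , h = α≤pᵇ ε 0<ε in N , λ i N≤i → ℚ.≤-trans (h i N≤i) (ℚ.+-monoˡ-≤ ε (qᵇ≤clq i))
      where
      qᵇ≤clq : ∀ i → q ^ b ℚ.≤ seq (clq G M) i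
      qᵇ≤clq i = subst (q ^ b ℚ.≤_) (sym (seq-clq M i))
        (^-antitone 0<q q≤1 (ℕ.≤-trans (edgeCount-mono ∣M∣≤k) edges-k≤b))

    αClique⇒∣M∣≤k : ∀ M → IsαClique G α M → ∣ M ∣ ≤ k
    αClique⇒∣M∣≤k M α≤clq = ℕ.≮⇒≥ λ k<∣M∣ →
      let ε , 0<ε , N , q+ε≤α = pᵇ⁺¹<α
          -- Half of the strict gap `ε` is a tolerance small enough for a contradiction at the
          -- single index `N ⊔ L`.
          L , α≤clq+½ε = α≤clq (½ ℚ.* ε) (½-pos 0<ε)
      in gap ε 0<ε (clq≤qᵇ⁺¹ k<∣M∣ (N ⊔ L)) (q+ε≤α (N ⊔ L) (ℕ.m≤m⊔n N L)) (α≤clq+½ε (N ⊔ L) (ℕ.m≤n⊔m N L))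
      where
      clq≤qᵇ⁺¹ : k < ∣ M ∣ → ∀ i → seq (clq G M) i ℚ.≤ q ^ suc b
      clq≤qᵇ⁺¹ k<∣M∣ i = subst (ℚ._≤ q ^ suc b) (sym (seq-clq M i))
        (^-antitone 0<q q≤1 (ℕ.≤-trans b<edges-k+1 (edgeCount-mono k<∣M∣)))
      gap : ∀ {x y z} ε → 0ℚ ℚ.< ε → z ℚ.≤ x → x ℚ.+ ε ℚ.≤ y → ¬ (y ℚ.≤ z ℚ.+ ½ ℚ.* ε)
      gap {x} {y} {z} ε 0<ε z≤x x+ε≤y y≤z+½ε = ℚ.<-irrefl refl (begin-strict
        x ℚ.+ ½ ℚ.* ε                    <⟨ ℚ.+-monoʳ-< x (q<p+q (½ ℚ.* ε) (½-pos 0<ε)) ⟩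
        x ℚ.+ (½ ℚ.* ε ℚ.+ ½ ℚ.* ε)      ≡⟨ cong (x ℚ.+_) (½-sum ε) ⟩
        x ℚ.+ ε                          ≤⟨ x+ε≤y ⟩
        y                                ≤⟨ y≤z+½ε ⟩
        z ℚ.+ ½ ℚ.* ε                    ≤⟨ ℚ.+-monoˡ-≤ (½ ℚ.* ε) z≤x ⟩
        x ℚ.+ ½ ℚ.* ε                    ∎)
        where open ℚ.≤-Reasoning

    ∣M∣≡k⇒αMaximal : ∀ M → ∣ M ∣ ≡ k → IsαMaximalClique G α M
    ∣M∣≡k⇒αMaximal M refl = ∣M∣≤k⇒αClique M ℕ.≤-refl , λ (v , v∉M , clique) →
      ℕ.<-irrefl refl (subst (_≤ k) (∣M∪⁅v⁆∣ M v∉M) (αClique⇒∣M∣≤k (M ∪ ⁅ v ⁆) clique))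

    αMaximal⇒∣M∣≡k : k < n → ∀ M → IsαMaximalClique G α M → ∣ M ∣ ≡ k
    αMaximal⇒∣M∣≡k k<n M (clique , maximal) =
      ℕ.≤-antisym (αClique⇒∣M∣≤k M clique) (ℕ.≮⇒≥ λ ∣M∣<k →
        let v , v∉M = ∣M∣<n⇒∃v∉M M (ℕ.<-trans ∣M∣<k k<n)
        in maximal (v , v∉M , ∣M∣≤k⇒αClique (M ∪ ⁅ v ⁆) (subst (_≤ k) (sym (∣M∪⁅v⁆∣ M v∉M)) ∣M∣<k)))

    αMaximal-count : k < n → HasCount (IsαMaximalClique G α) (n C k)
    αMaximal-count k<n = subsetsOfSize n k , subsetsOfSize-unique n k
      , (λ M → mk⇔ (∣M∣≡k⇒αMaximal M ∘ ∈-subsetsOfSize⁻ n k) (∈-subsetsOfSize⁺ M ∘ αMaximal⇒∣M∣≡k k<n M))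
      , length-subsetsOfSize n k

-- The maximum, from both bounds

theorem1 : (n : ℕ) → 2 ≤ n → (α : ℝ) → 0ᴿ <ᴿ α → α <ᴿ 1ᴿ →
    MaxCliqueCount n α (n C ⌊ n /2⌋)
theorem1 (suc (suc n)) 2≤n α 0<α α<1 = attained , λ k (G , count) → αMaximal-count≤ G α count
  where
  s b : ℕ
  s = ⌊ suc (suc n) /2⌋
  -- Here `n` is two less than the number of vertices, so `s` is `suc ⌊ n /2⌋` and `suc b` equals
  -- `edgeCount (suc s)` by computation: `b` is the largest exponent below that edge count.
  b = ⌊ n /2⌋ ℕ.+ edgeCount s
  attained : Σ[ G ∈ UncertainGraph (suc (suc n)) ] HasCount (IsαMaximalClique G α) (suc (suc n) C s)
  attained =
    let q , 0<q , q≤1 , qᵇ⁺¹<α , α≤qᵇ = real-power-separation α b 0<α α<1 in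
    completeGraph (suc (suc n)) q 0<q q≤1 ,
    αMaximal-count 0<q q≤1 {α} {s} {b} (ℕ.m≤n+m (edgeCount s) ⌊ n /2⌋) ℕ.≤-refl qᵇ⁺¹<α α≤qᵇ (ℕ.⌊n/2⌋<n (suc n))
theorem1 (suc zero) (s≤s ())
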